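{- For all integers $\alpha\ge 1$ and $n\ge 0$, \[\overline{p}\big(5^{2\alpha+1}(5n+1)\big)\equiv \overline{p}\big(5^{2\alpha+1}(5n+4)\big)\equiv 0 \pmod 5.\]
   Context: An overpartition of a nonnegative integer $n$ is a partition of $n$ in which the first occurrence of each distinct part may (or may not) be overlined; $\overline{p}(n)$ denotes the number of overpartitions of $n$ (with $\overline{p}(0)=1$). Equivalently, $\sum_{n\ge0}\overline{p}(n)q^n=\prod_{k\ge1}\frac{1+q^k}{1-q^k}$. -}

module Defs where

open import Data.Bool using (Bool; true; false)
import Data.Bool.Properties as Bool
open import Data.Empty using (⊥)
open import Data.List using (List; []; _∷_; length; map; upTo; filter; cartesianProductWith)
open import Data.List.Properties using (∷-injective)
open import Data.List.Membership.Propositional using (_∈_)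
open import Data.List.Membership.Propositional.Properties using (∈-cartesianProductWith⁺; ∈-upTo⁺; ∈-map⁺; ∈-map⁻; ∈-filter⁺; ∈-filter⁻; ∈-cartesianProductWith⁻)
open import Data.List.Relation.Unary.All as All using (All; []; _∷_)
open import Data.List.Relation.Unary.AllPairs using ([]; _∷_)
open import Data.List.Relation.Unary.Any using (here; there)
open import Data.List.Relation.Unary.Linked using (Linked; linked?)
open import Data.List.Relation.Unary.Unique.Propositional using (Unique)
open import Data.List.Relation.Unary.Unique.Propositional.Properties using (map⁺; upTo⁺; filter⁺; cartesianProductWith⁺)
open import Data.Nat using (ℕ; zero; suc; _≤_; _>_; z≤n; s≤s; _≟_; _<?_; _≤?_)
open import Data.Nat.ListAction using (sum)
open import Data.Nat.Properties using (≤-trans; +-mono-≤; m≤m+n; m≤n+m; ≤-reflexive; suc-injective)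
open import Data.Product using (_×_; _,_; ∃₂; proj₂)
open import Data.Sum using (_⊎_)
open import Function.Bundles using (_⇔_; mk⇔)
open import Relation.Binary.PropositionalEquality using (_≡_; refl; subst)
open import Relation.Nullary using (Dec)
open import Relation.Nullary.Decidable using (_×-dec_; _⊎-dec_)

record Part : Set where
  constructor part
  field
    size      : ℕ
    overlined : Bool

open Part public

-- Admissible consecutive parts p, q when parts are listed in weakly decreasing
-- order: if q has the same size as p then q is not the first occurrence of its
-- size, so it must not be overlined.
_≽_ : Part → Part → Set
p ≽ q = (size p > size q) ⊎ (size p ≡ size q × overlined q ≡ false)

IsOverpartition : ℕ → List Part → Set
IsOverpartition n ps = All (λ p → 1 ≤ size p) ps × Linked _≽_ ps × sum (map size ps) ≡ n

_≽?_ : ∀ p q → Dec (p ≽ q)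
p ≽? q = (size q <? size p) ⊎-dec ((size p ≟ size q) ×-dec (overlined q Bool.≟ false))

isOverpartition? : ∀ n ps → Dec (IsOverpartition n ps)
isOverpartition? n ps =
  All.all? (λ p → 1 ≤? size p) ps ×-dec (linked? _≽?_ ps ×-dec (sum (map size ps) ≟ n))

-- All parts with size in {1, …, n}.
partsUpTo : ℕ → List Part
partsUpTo n = cartesianProductWith part (map suc (upTo n)) (false ∷ true ∷ [])

-- All lists of length at most k with entries in xs.
listsUpTo : {A : Set} → List A → ℕ → List (List A)
listsUpTo xs zero    = [] ∷ []
listsUpTo xs (suc k) = [] ∷ cartesianProductWith _∷_ xs (listsUpTo xs k)

-- An overpartition of n has at most n parts, each of size at most n, so nothing
-- is missed; see ∈-overpartitions and overpartitions-unique below.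
overpartitions : ℕ → List (List Part)
overpartitions n = filter (isOverpartition? n) (listsUpTo (partsUpTo n) n)

p̄ : ℕ → ℕ
p̄ n = length (overpartitions n)

private
  ∈-partsUpTo : ∀ {n} p → 1 ≤ size p → size p ≤ n → p ∈ partsUpTo n
  ∈-partsUpTo (part (suc m) b) _ m<n =
    ∈-cartesianProductWith⁺ part (∈-map⁺ suc (∈-upTo⁺ m<n)) (∈-bools b)
    where
    ∈-bools : ∀ b → b ∈ (false ∷ true ∷ [])
    ∈-bools false = here refl
    ∈-bools true  = there (here refl)

  ∈-listsUpTo : {A : Set} {xs : List A} (k : ℕ) (ys : List A) →
                All (_∈ xs) ys → length ys ≤ k → ys ∈ listsUpTo xs k
  ∈-listsUpTo zero    []       _          _         = here refl
  ∈-listsUpTo (suc k) []       _          _         = here refl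
  ∈-listsUpTo (suc k) (y ∷ ys) (y∈ ∷ ys∈) (s≤s len) =
    there (∈-cartesianProductWith⁺ _∷_ y∈ (∈-listsUpTo k ys ys∈ len))

  length≤sum : ∀ ps → All (λ p → 1 ≤ size p) ps → length ps ≤ sum (map size ps)
  length≤sum []       []         = z≤n
  length≤sum (p ∷ ps) (1≤ ∷ 1≤s) = +-mono-≤ 1≤ (length≤sum ps 1≤s)

  parts-bounded : ∀ {n} ps → All (λ p → 1 ≤ size p) ps → sum (map size ps) ≤ n →
                  All (_∈ partsUpTo n) ps
  parts-bounded []       []         _ = []
  parts-bounded (p ∷ ps) (1≤ ∷ 1≤s) h =
    ∈-partsUpTo p 1≤ (≤-trans (m≤m+n (size p) _) h)
    ∷ parts-bounded ps 1≤s (≤-trans (m≤n+m _ (size p)) h)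

  partsUpTo-unique : ∀ n → Unique (partsUpTo n)
  partsUpTo-unique n =
    cartesianProductWith⁺ part (λ { refl → refl , refl })
      (map⁺ suc-injective (upTo⁺ n)) (((λ ()) ∷ []) ∷ [] ∷ [])

  listsUpTo-unique : {A : Set} {xs : List A} → Unique xs → ∀ k → Unique (listsUpTo xs k)
  listsUpTo-unique u zero = [] ∷ []
  listsUpTo-unique {xs = xs} u (suc k) =
    All.tabulate (λ { v∈ refl → nonempty (∈-cartesianProductWith⁻ _∷_ xs (listsUpTo xs k) v∈) })
    ∷ cartesianProductWith⁺ _∷_ ∷-injective u (listsUpTo-unique u k)
    where
    nonempty : ∃₂ (λ a b → a ∈ xs × b ∈ listsUpTo xs k × [] ≡ a ∷ b) → ⊥
    nonempty (_ , _ , _ , _ , ())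

∈-overpartitions : ∀ n ps → ps ∈ overpartitions n ⇔ IsOverpartition n ps
∈-overpartitions n ps = mk⇔ sound complete
  where
  sound : ps ∈ overpartitions n → IsOverpartition n ps
  sound ps∈ = proj₂ (∈-filter⁻ (isOverpartition? n) {xs = listsUpTo (partsUpTo n) n} ps∈)

  complete : IsOverpartition n ps → ps ∈ overpartitions n
  complete o@(pos , _ , total) =
    ∈-filter⁺ (isOverpartition? n)
      (∈-listsUpTo n ps (parts-bounded ps pos (≤-reflexive total))
        (subst (length ps ≤_) total (length≤sum ps pos)))
      o

overpartitions-unique : ∀ n → Unique (overpartitions n)
overpartitions-unique n = filter⁺ (isOverpartition? n) (listsUpTo-unique (partsUpTo-unique n) n)

{-# OPTIONS --safe #-}
module Submission where

-- Write φ = Σ_{x ∈ ℤ} q^{x²} and Q = Σ (−1)^n p̄(n) q^n, let U extract the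
-- coefficients of q^{5n} and let V be the substitution q ↦ q⁵.  By Gauss's
-- identity, Q φ = 1.  Counting Gaussian integers of norm 5n through the
-- factors 2 ± i of 5 gives U(φ²) = 2φ² − (Vφ)².  Split φ = φ₀ + φ₁ + φ₄
-- according to the exponents modulo 5, so that φ₀ = VVφ.  The formula for
-- U(φ²) then reads φ₀² + φ₁φ₄ = (Vφ)².  Working modulo 5 from now on, it yields
--   U(φ⁴) = φ⁴,   U(φ³) = Vφ · φ²,   U(Vφ · φ²) = H,   U(H) = Vφ · φ²
-- with H = 2φ³ − φ (Vφ)², and H has no exponents ≡ ±1 (mod 5).  Since φ⁵ = Vφ,
-- we get U(Q) φ = U(Q Vφ) = U(φ⁴) = φ⁴, so U(Q) = φ³.  Hence
-- U^{2α+1}(Q) = H for every α ≥ 1.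

open import Defs
open import Algebra.Bundles using (CommutativeRing; RawRing)
import Algebra.Properties.CommutativeSemiring.Exp as CExp
import Algebra.Properties.Group as GroupProperties
import Algebra.Properties.Ring as RingProperties
import Algebra.Properties.Semiring.Exp as Exp
import Algebra.Properties.Semiring.Mult.TCOptimised as Mult
import Algebra.Solver.Ring as Solver
open import Algebra.Solver.Ring.AlmostCommutativeRing using (_-Raw-AlmostCommutative⟶_; fromCommutativeRing)
import Algebra.Solver.Ring.NaturalCoefficients.Default as NatSolver
open import Data.Bool using (Bool; true; false)
open import Data.Empty using (⊥-elim)
open import Data.Integer as ℤ using (ℤ; ∣_∣)
open import Data.Integer.Divisibility.Signed as ℤ∣ using (divides)
import Data.Integer.Properties as ℤ
open import Data.Integer.Tactic.RingSolver using (solve-∀)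
open import Data.List using (List; []; _∷_; length; map; filter; _++_; cartesianProduct)
open import Data.List.Membership.Propositional using (_∈_)
open import Data.List.Membership.Propositional.Properties using (∈-map⁺; ∈-map⁻; ∈-filter⁺; ∈-filter⁻; ∈-++⁺ˡ; ∈-++⁺ʳ; ∈-++⁻; ∈-cartesianProduct⁺)
open import Data.List.Membership.Propositional.Properties.WithK using (unique∧set⇒bag)
open import Data.List.Properties using (length-++; length-map; ∷-injectiveʳ; filter-all; filter-++; filter-accept; filter-reject)
open import Data.List.Relation.Binary.BagAndSetEquality using (∼bag⇒↭)
open import Data.List.Relation.Binary.Disjoint.Propositional using (Disjoint)
open import Data.List.Relation.Binary.Permutation.Propositional.Properties using (↭-length)
open import Data.List.Relation.Unary.All as All using ([]; _∷_)
open import Data.List.Relation.Unary.AllPairs using ([]; _∷_)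
open import Data.List.Relation.Unary.Any using (here; there)
open import Data.List.Relation.Unary.Linked using ([]; [-]; _∷_)
open import Data.List.Relation.Unary.Unique.Propositional using (Unique)
open import Data.List.Relation.Unary.Unique.Propositional.Properties using (map⁺; filter⁺; ++⁺; cartesianProduct⁺)
open import Data.Maybe using (Maybe; just; nothing)
open import Data.Nat as ℕ using (ℕ; zero; suc; _≤_; _<_; z≤n; s≤s; _%_; _/_)
import Data.Nat.Divisibility as ℕ
import Data.Nat.DivMod as ℕ
open import Data.Nat.Primality using (Prime; prime?; euclidsLemma)
import Data.Nat.Properties as ℕ
open import Data.Product using (_×_; _,_; ∃; proj₁; proj₂)
open import Data.Sum using (_⊎_; inj₁; inj₂; reduce)
open import Data.Unit using (⊤; tt)
open import Function.Bundles using (mk⇔; Equivalence)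
open import Relation.Binary.PropositionalEquality as ≡ using (_≡_; _≢_)
import Relation.Binary.Reasoning.Setoid as SetoidReasoning
open import Relation.Nullary using (Dec; yes; no; ¬_)
open import Relation.Nullary.Decidable using (_×-dec_; from-yes)

-- The signs in `Q` are there so that its inverse has none: at x = -q, Gauss's sum of (-1)^j x^(j²)
-- is `φ`, whose coefficients count integers with a given square, and those of its square count
-- lattice points on circles. A sign does not affect divisibility by 5. A single quadratic relation
-- controls both the third and the fourth power because of the multinomial coefficients modulo 5:
-- with s = φ₀² + φ₁φ₄, the part of φ⁴ in exponents divisible by 5 collapses to s², and the parts of
-- φ³ in the residues 0, 1, 4 are φ₀s, 3φ₁s, 3φ₄s. The case α = 0 is out of reach since U(Q) = φ³
-- still carries 3φ₁s and 3φ₄s; indeed p̄(5) = 24. They are removed only by the summand -φ(Vφ)² of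
-- `H`, which the third application of U produces. Infinite products and limits are avoided: Gauss's
-- identity is proved for finite products with a remainder divisible by x^(n+1), and the
-- coefficients of `Q * φ` are then settled one degree at a time.

module PowerSeries {c ℓ} (R : CommutativeRing c ℓ) where
  private
    module R = CommutativeRing R
    module S = NatSolver R.commutativeSemiring
    open S using (_:+_; _:*_; _:=_)

  -- The ring of formal power series

  Series : Set c
  Series = ℕ → R.Carrier

  infix  4 _≋_
  infixl 6 _⊕_
  infixl 7 _⊛_

  -- A record instead of the bare pointwise statement, so that both series can be inferred from the
  -- type of an equation.
  record _≋_ (f g : Series) : Set ℓ where
    constructor coeffwise
    field coeff : ∀ n → f n R.≈ g n
  open _≋_ public

  _⊕_ : Series → Series → Series
  (f ⊕ g) n = f n R.+ g n

  const : R.Carrier → Series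
  const a zero    = a
  const a (suc _) = R.0#

  tail : Series → Series
  tail f n = f (suc n)

  -- The Cauchy product, read off from f g = f(0) g + q (tail f) g. In this form the ring laws are
  -- inductions on the degree, with no sums to reindex.
  _⊛_ : Series → Series → Series
  (f ⊛ g) zero    = f 0 R.* g 0
  (f ⊛ g) (suc n) = f 0 R.* g (suc n) R.+ (tail f ⊛ g) n

  -- Coefficient n of a product sees its factors only up to degree n. This allows a series to be
  -- replaced by a truncation chosen for each n.
  ⊛-cong-≤ : ∀ n {f f′ g g′} → (∀ i → i ≤ n → f i R.≈ f′ i) → (∀ i → i ≤ n → g i R.≈ g′ i) →
             (f ⊛ g) n R.≈ (f′ ⊛ g′) n
  ⊛-cong-≤ zero    p q = R.*-cong (p 0 z≤n) (q 0 z≤n)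
  ⊛-cong-≤ (suc n) p q = R.+-cong (R.*-cong (p 0 z≤n) (q (suc n) ℕ.≤-refl))
    (⊛-cong-≤ n (λ i i≤n → p (suc i) (s≤s i≤n)) (λ i i≤n → q i (ℕ.m≤n⇒m≤1+n i≤n)))

  ⊛-vanish : ∀ n {f g} → (∀ i j → i ℕ.+ j ≡ n → f i R.* g j R.≈ R.0#) → (f ⊛ g) n R.≈ R.0#
  ⊛-vanish zero    p = p 0 0 ≡.refl
  ⊛-vanish (suc n) p = R.trans
    (R.+-cong (p 0 (suc n) ≡.refl) (⊛-vanish n (λ i j eq → p (suc i) j (≡.cong suc eq))))
    (R.+-identityˡ _)

  ⊛-distribʳ : ∀ n f g h → ((f ⊕ g) ⊛ h) n R.≈ (f ⊛ h) n R.+ (g ⊛ h) n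
  ⊛-distribʳ zero    f g h = R.distribʳ _ _ _
  ⊛-distribʳ (suc n) f g h = R.trans (R.+-congˡ (⊛-distribʳ n (tail f) (tail g) h))
    (S.solve 5 (λ a b c x y → (a :+ b) :* c :+ (x :+ y) := (a :* c :+ x) :+ (b :* c :+ y))
      R.refl (f 0) (g 0) (h (suc n)) ((tail f ⊛ h) n) ((tail g ⊛ h) n))

  ⊛-scale : ∀ n a f g → ((λ i → a R.* f i) ⊛ g) n R.≈ a R.* (f ⊛ g) n
  ⊛-scale zero    a f g = R.*-assoc _ _ _
  ⊛-scale (suc n) a f g = R.trans (R.+-congˡ (⊛-scale n a (tail f) g))
    (S.solve 4 (λ a b c x → (a :* b) :* c :+ a :* x := a :* (b :* c :+ x))
      R.refl a (f 0) (g (suc n)) ((tail f ⊛ g) n))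

  -- The defining recursion with the factors in exchanged roles; commutativity compares the two.
  ⊛-suc : ∀ n f g → (f ⊛ g) (suc n) R.≈ f (suc n) R.* g 0 R.+ (f ⊛ tail g) n
  ⊛-suc zero    f g = R.+-comm _ _
  ⊛-suc (suc n) f g = R.trans (R.+-congˡ (⊛-suc n (tail f) g))
    (S.solve 3 (λ x y z → x :+ (y :+ z) := y :+ (x :+ z))
      R.refl (f 0 R.* g (2 ℕ.+ n)) (f (2 ℕ.+ n) R.* g 0) ((tail f ⊛ tail g) n))

  ⊛-comm : ∀ n f g → (f ⊛ g) n R.≈ (g ⊛ f) n
  ⊛-comm zero    f g = R.*-comm _ _
  ⊛-comm (suc n) f g = R.trans
    (R.+-cong (R.*-comm _ _) (⊛-comm n (tail f) g))
    (R.sym (⊛-suc n g f))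

  ⊛-assoc : ∀ n f g h → ((f ⊛ g) ⊛ h) n R.≈ (f ⊛ (g ⊛ h)) n
  ⊛-assoc zero    f g h = R.*-assoc _ _ _
  ⊛-assoc (suc n) f g h = R.trans
    (R.+-congˡ (R.trans (⊛-distribʳ n (λ i → f 0 R.* g (suc i)) (tail f ⊛ g) h)
      (R.+-cong (⊛-scale n (f 0) (tail g) h) (⊛-assoc n (tail f) g h))))
    (S.solve 5 (λ a b c x y → (a :* b) :* c :+ (a :* x :+ y) := a :* (b :* c :+ x) :+ y)
      R.refl (f 0) (g 0) (h (suc n)) ((tail g ⊛ h) n) ((tail f ⊛ (g ⊛ h)) n))

  ⊛-zeroˡ : ∀ n g → ((λ _ → R.0#) ⊛ g) n R.≈ R.0#
  ⊛-zeroˡ n g = ⊛-vanish n (λ _ _ _ → R.zeroˡ _)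

  const-⊛ : ∀ a g n → (const a ⊛ g) n R.≈ a R.* g n
  const-⊛ a g zero    = R.refl
  const-⊛ a g (suc n) = R.trans (R.+-congˡ (⊛-zeroˡ n g)) (R.+-identityʳ _)

  ring : CommutativeRing c ℓ
  ring = record
    { Carrier = Series ; _≈_ = _≋_ ; _+_ = _⊕_ ; _*_ = _⊛_ ; -_ = λ f n → R.- f n
    ; 0# = λ _ → R.0# ; 1# = const R.1#
    ; isCommutativeRing = record
      { isRing = record
        { +-isAbelianGroup = record
          { isGroup = record
            { isMonoid = record
              { isSemigroup = record
                { isMagma = record
                  { isEquivalence = record
                    { refl  = coeffwise λ _ → R.refl
                    ; sym   = λ p → coeffwise λ n → R.sym (coeff p n)
                    ; trans = λ p q → coeffwise λ n → R.trans (coeff p n) (coeff q n)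
                    }
                  ; ∙-cong = λ p q → coeffwise λ n → R.+-cong (coeff p n) (coeff q n)
                  }
                ; assoc = λ _ _ _ → coeffwise λ _ → R.+-assoc _ _ _
                }
              ; identity = (λ _ → coeffwise λ _ → R.+-identityˡ _) , (λ _ → coeffwise λ _ → R.+-identityʳ _)
              }
            ; inverse = (λ _ → coeffwise λ _ → R.-‿inverseˡ _) , (λ _ → coeffwise λ _ → R.-‿inverseʳ _)
            ; ⁻¹-cong = λ p → coeffwise λ n → R.-‿cong (coeff p n)
            }
          ; comm = λ _ _ → coeffwise λ _ → R.+-comm _ _
          }
        ; *-cong = λ p q → coeffwise λ n → ⊛-cong-≤ n (λ i _ → coeff p i) (λ i _ → coeff q i)
        ; *-assoc = λ f g h → coeffwise λ n → ⊛-assoc n f g h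
        ; *-identity = (λ f → coeffwise (1⊛ f)) , (λ f → coeffwise λ n → R.trans (⊛-comm n f _) (1⊛ f n))
        ; distrib = (λ f g h → coeffwise λ n → R.trans (⊛-comm n f (g ⊕ h))
                      (R.trans (⊛-distribʳ n g h f) (R.+-cong (⊛-comm n g f) (⊛-comm n h f))))
                  , (λ f g h → coeffwise λ n → ⊛-distribʳ n g h f)
        }
      ; *-comm = λ f g → coeffwise λ n → ⊛-comm n f g
      }
    }
    where
    1⊛ : ∀ f n → (const R.1# ⊛ f) n R.≈ f n
    1⊛ f n = R.trans (const-⊛ R.1# f n) (R.*-identityˡ _)

  private
    module K = CommutativeRing ring
  open CommutativeRing ring using (_≈_; _+_; _*_; -_; 0#; 1#)
  open RingProperties K.ring using (-‿distribˡ-*)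
  open Exp K.semiring using (_^_)

  -- Cancellation modulo q^(n+1): in each coefficient of the product, every term except f(0) times
  -- the newest coefficient of `h` contains an earlier coefficient of `h`, already known to vanish.
  vanish-cancelˡ : ∀ n {f h} → f 0 R.≈ R.1# → (∀ i → i ≤ n → (f ⊛ h) i R.≈ R.0#) →
                   ∀ i → i ≤ n → h i R.≈ R.0#
  vanish-cancelˡ n {f} {h} f0 p zero z≤n =
    R.trans (R.sym (R.*-identityˡ _)) (R.trans (R.*-congʳ (R.sym f0)) (p 0 z≤n))
  vanish-cancelˡ (suc n) {f} {h} f0 p (suc i) (s≤s i≤n) = begin
    h (suc i)                             ≈⟨ R.*-identityˡ _ ⟨
    R.1# R.* h (suc i)                    ≈⟨ R.*-congʳ f0 ⟨
    f 0 R.* h (suc i)                     ≈⟨ R.+-identityʳ _ ⟨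
    f 0 R.* h (suc i) R.+ R.0#            ≈⟨ R.+-congˡ lower ⟨
    f 0 R.* h (suc i) R.+ (tail f ⊛ h) i  ≈⟨ p (suc i) (s≤s i≤n) ⟩
    R.0#                                  ∎
    where
    open SetoidReasoning R.setoid
    lower : (tail f ⊛ h) i R.≈ R.0#
    lower = ⊛-vanish i λ j k eq → R.trans
      (R.*-congˡ (vanish-cancelˡ n f0 (λ l l≤n → p l (ℕ.m≤n⇒m≤1+n l≤n)) k
        (ℕ.≤-trans (ℕ.m+n≤o⇒n≤o j (ℕ.≤-reflexive eq)) i≤n)))
      (R.zeroʳ _)

  const-* : ∀ a b → const (a R.* b) ≈ const a * const b
  const-* a b = coeffwise λ where
    zero    → R.refl
    (suc n) → R.sym (R.trans (const-⊛ a (const b) (suc n)) (R.zeroʳ a))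

  -- Multiplication by powers of q, and the substitution of -q

  X : Series
  X 1 = R.1#
  X _ = R.0#

  shift : ℕ → Series → Series
  shift zero    f n       = f n
  shift (suc k) f zero    = R.0#
  shift (suc k) f (suc n) = shift k f n

  X⊛-suc : ∀ f n → (X ⊛ f) (suc n) R.≈ f n
  X⊛-suc f n = R.trans (R.+-cong (R.zeroˡ _) (R.trans
    (⊛-cong-≤ n tailX (λ _ _ → R.refl)) (R.trans (const-⊛ R.1# f n) (R.*-identityˡ _)))) (R.+-identityˡ _)
    where
    tailX : ∀ i → i ≤ n → tail X i R.≈ const R.1# i
    tailX zero    _ = R.refl
    tailX (suc _) _ = R.refl

  X^-⊛ : ∀ k f → X ^ k * f ≈ shift k f
  X^-⊛ zero    f = K.*-identityˡ f
  X^-⊛ (suc k) f = K.trans (K.*-assoc X (X ^ k) f) (coeffwise λ where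
    zero    → R.zeroˡ _
    (suc n) → R.trans (X⊛-suc (X ^ k * f) n) (coeff (X^-⊛ k f) n))

  decompose : ∀ f → f ≈ const (f 0) + X * tail f
  decompose f = coeffwise λ where
    zero    → R.sym (R.trans (R.+-congˡ (R.zeroˡ _)) (R.+-identityʳ _))
    (suc n) → R.sym (R.trans (R.+-congˡ (X⊛-suc (tail f) n)) (R.+-identityˡ _))

  sgn : ℕ → R.Carrier
  sgn zero    = R.1#
  sgn (suc n) = R.- sgn n

  -- The substitution q ↦ −q.
  alternate : Series → Series
  alternate f n = sgn n R.* f n

  alternate-cong : ∀ {f g} → f ≈ g → alternate f ≈ alternate g
  alternate-cong p = coeffwise λ n → R.*-congˡ (coeff p n)

  alternate-+ : ∀ f g → alternate (f + g) ≈ alternate f + alternate g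
  alternate-+ f g = coeffwise λ n → R.distribˡ _ _ _

  sgn-involutive : ∀ n → sgn n R.* sgn n R.≈ R.1#
  sgn-involutive zero    = R.*-identityˡ _
  sgn-involutive (suc n) = begin
    R.- sgn n R.* R.- sgn n      ≈⟨ P.-‿distribˡ-* _ _ ⟨
    R.- (sgn n R.* R.- sgn n)    ≈⟨ R.-‿cong (P.-‿distribʳ-* _ _) ⟨
    R.- (R.- (sgn n R.* sgn n))  ≈⟨ P.-‿involutive _ ⟩
    sgn n R.* sgn n              ≈⟨ sgn-involutive n ⟩
    R.1#                         ∎
    where
    open SetoidReasoning R.setoid
    module P = RingProperties R.ring

  alternate-shift : ∀ k f → alternate (shift k f) ≈ (- X) ^ k * alternate f
  alternate-shift zero    f = K.sym (K.*-identityˡ _)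
  alternate-shift (suc k) f = begin
    alternate (shift (suc k) f)        ≈⟨ coeffwise step ⟩
    - (X * alternate (shift k f))      ≈⟨ K.-‿cong (K.*-congˡ (alternate-shift k f)) ⟩
    - (X * ((- X) ^ k * alternate f))  ≈⟨ -‿distribˡ-* _ _ ⟩
    - X * ((- X) ^ k * alternate f)    ≈⟨ K.*-assoc _ _ _ ⟨
    (- X) ^ suc k * alternate f        ∎
    where
    open SetoidReasoning K.setoid
    module P = RingProperties R.ring
    step : ∀ n → alternate (shift (suc k) f) n R.≈ R.- (X * alternate (shift k f)) n
    step zero    = R.trans (R.zeroʳ _) (R.sym (R.trans (R.-‿cong (R.zeroˡ _)) P.-0#≈0#))
    step (suc n) = R.trans (R.sym (P.-‿distribˡ-* _ _)) (R.-‿cong (R.sym (X⊛-suc _ n)))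

  -- Sections modulo 5 and the substitution of q⁵

  U₅ V₅ : Series → Series
  -- With `n * 5` the index at `suc n` reduces to five successors of `n * 5`, in step with the
  -- recursion of `V₅`, so the laws relating the two maps hold largely by computation.
  U₅ f n = f (n ℕ.* 5)
  V₅ f 0 = f 0
  V₅ f 1 = R.0#
  V₅ f 2 = R.0#
  V₅ f 3 = R.0#
  V₅ f 4 = R.0#
  V₅ f (suc (suc (suc (suc (suc n))))) = V₅ (tail f) n

  U₅-cong : ∀ {f g} → f ≈ g → U₅ f ≈ U₅ g
  U₅-cong p = coeffwise λ n → coeff p (n ℕ.* 5)

  V₅-cong : ∀ {f g} → f ≈ g → V₅ f ≈ V₅ g
  V₅-cong p = coeffwise λ n → go n p
    where
    go : ∀ n {f g} → f ≈ g → V₅ f n R.≈ V₅ g n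
    go 0 p = coeff p 0
    go 1 p = R.refl
    go 2 p = R.refl
    go 3 p = R.refl
    go 4 p = R.refl
    go (suc (suc (suc (suc (suc n))))) p = go n (coeffwise λ i → coeff p (suc i))

  U₅V₅ : ∀ f → U₅ (V₅ f) ≈ f
  U₅V₅ f = coeffwise λ n → R.reflexive (go n f)
    where
    go : ∀ n f → V₅ f (n ℕ.* 5) ≡ f n
    go zero    f = ≡.refl
    go (suc n) f = go n (tail f)

  -- Of any five consecutive coefficients of `V₅ f` only one can be nonzero, so every five degrees
  -- of the product contribute a single term. This rule for pulling series in q⁵ out of `U₅` drives
  -- the later evaluations.
  U₅-V₅⊛ : ∀ f g → U₅ (V₅ f * g) ≈ f * U₅ g
  U₅-V₅⊛ f g = coeffwise λ n → go n f
    where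
    go : ∀ n f → (V₅ f ⊛ g) (n ℕ.* 5) R.≈ (f ⊛ U₅ g) n
    go zero    f = R.refl
    go (suc n) f = R.+-congˡ (drop (drop (drop (drop (go n (tail f))))))
      where
      drop : ∀ {a x y} → x R.≈ y → R.0# R.* a R.+ x R.≈ y
      drop p = R.trans (R.+-cong (R.zeroˡ _) p) (R.+-identityˡ _)

  U₅-⊛V₅ : ∀ f g → U₅ (f * V₅ g) ≈ U₅ f * g
  U₅-⊛V₅ f g = K.trans (U₅-cong (K.*-comm f (V₅ g))) (K.trans (U₅-V₅⊛ g f) (K.*-comm g (U₅ f)))

  -- Reducing `r` inside the definition makes this a grading without bookkeeping: degrees simply add
  -- under products, and for instance `4 + 4` and `3` give the same condition by computation.
  SupportedOn : ℕ → Series → Set ℓ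
  SupportedOn r f = ∀ n → n % 5 ≢ r % 5 → f n R.≈ R.0#

  supp-+ : ∀ r {f g} → SupportedOn r f → SupportedOn r g → SupportedOn r (f + g)
  supp-+ r p q n n≢ = R.trans (R.+-cong (p n n≢) (q n n≢)) (R.+-identityˡ _)

  supp-* : ∀ r s {f g} → SupportedOn r f → SupportedOn s g → SupportedOn (r ℕ.+ s) (f * g)
  supp-* r s {f} {g} p q n n≢ = ⊛-vanish n term
    where
    term : ∀ i j → i ℕ.+ j ≡ n → f i R.* g j R.≈ R.0#
    term i j eq with i % 5 ℕ.≟ r % 5 | j % 5 ℕ.≟ s % 5
    ... | no i≢  | _      = R.trans (R.*-congʳ (p i i≢)) (R.zeroˡ _)
    ... | yes _  | no j≢  = R.trans (R.*-congˡ (q j j≢)) (R.zeroʳ _)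
    ... | yes i≡ | yes j≡ = ⊥-elim (n≢ (≡.trans (≡.cong (_% 5) (≡.sym eq))
      (≡.trans (ℕ.%-distribˡ-+ i j 5)
        (≡.trans (≡.cong₂ (λ a b → (a ℕ.+ b) % 5) i≡ j≡) (≡.sym (ℕ.%-distribˡ-+ r s 5))))))

  supp-V₅ : ∀ f → SupportedOn 0 (V₅ f)
  supp-V₅ f 0 n≢ = ⊥-elim (n≢ ≡.refl)
  supp-V₅ f 1 n≢ = R.refl
  supp-V₅ f 2 n≢ = R.refl
  supp-V₅ f 3 n≢ = R.refl
  supp-V₅ f 4 n≢ = R.refl
  supp-V₅ f (suc (suc (suc (suc (suc n))))) n≢ = supp-V₅ (tail f) n n≢

  supp-U₅ : ∀ r {f} → r % 5 ≢ 0 → SupportedOn r f → U₅ f ≈ 0#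
  supp-U₅ r r≢0 p = coeffwise λ n → p (n ℕ.* 5) (λ eq → r≢0 (≡.trans (≡.sym eq) (ℕ.m*n%n≡0 n 5)))

  V₅U₅ : ∀ {f} → SupportedOn 0 f → V₅ (U₅ f) ≈ f
  V₅U₅ p = coeffwise λ n → go n p
    where
    go : ∀ n {f} → SupportedOn 0 f → V₅ (U₅ f) n R.≈ f n
    go 0 p = R.refl
    go 1 p = R.sym (p 1 (λ ()))
    go 2 p = R.sym (p 2 (λ ()))
    go 3 p = R.sym (p 3 (λ ()))
    go 4 p = R.sym (p 4 (λ ()))
    go (suc (suc (suc (suc (suc n))))) p = go n (λ i → p (5 ℕ.+ i))

  -- A series in q⁵ is determined by its image under `U₅`. The product `V₅ f * V₅ g` is such a
  -- series, and pulling out `f` shows that its image is `f * g`.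
  V₅-* : ∀ f g → V₅ (f * g) ≈ V₅ f * V₅ g
  V₅-* f g = K.trans
    (V₅-cong (K.sym (K.trans (U₅-V₅⊛ f (V₅ g)) (K.*-congˡ (U₅V₅ g)))))
    (V₅U₅ (supp-* 0 0 (supp-V₅ f) (supp-V₅ g)))

-- Polynomial identities in characteristic 5

Char5 : ∀ {c ℓ} → CommutativeRing c ℓ → Set ℓ
Char5 K = 5 · 1# ≈ 0#
  where
  open CommutativeRing K
  open Mult semiring renaming (_×_ to _·_)

-- Coefficients are reduced modulo 5 after every operation, so that the normal
-- forms compared by the solver are canonical; 4 n plays the role of − n.
module Char5Solver {c ℓ} (K : CommutativeRing c ℓ) (5≈0 : Char5 K) where
  open CommutativeRing K
  open Mult semiring renaming (_×_ to _·_)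
  private
    open SetoidReasoning setoid

    coefficients : RawRing _ _
    coefficients = record
      { Carrier = ℕ ; _≈_ = _≡_ ; _+_ = λ m n → (m ℕ.+ n) % 5 ; _*_ = λ m n → (m ℕ.* n) % 5
      ; -_ = λ n → (4 ℕ.* n) % 5 ; 0# = 0 ; 1# = 1 }

    multiple≈0 : ∀ k → (k ℕ.* 5) · 1# ≈ 0#
    multiple≈0 k = trans (×1-homo-* k 5) (trans (*-congˡ 5≈0) (zeroʳ _))

    residue : ∀ m → m · 1# ≈ (m % 5) · 1#
    residue m = begin
      m · 1#                             ≡⟨ ≡.cong (_· 1#) (ℕ.m≡m%n+[m/n]*n m 5) ⟩
      (m % 5 ℕ.+ m / 5 ℕ.* 5) · 1#       ≈⟨ ×-homo-+ 1# (m % 5) _ ⟩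
      (m % 5) · 1# + (m / 5 ℕ.* 5) · 1#  ≈⟨ +-congˡ (multiple≈0 (m / 5)) ⟩
      (m % 5) · 1# + 0#                  ≈⟨ +-identityʳ _ ⟩
      (m % 5) · 1#                       ∎

    -‿homo : ∀ n → ((4 ℕ.* n) % 5) · 1# ≈ - (n · 1#)
    -‿homo n = trans (sym (residue (4 ℕ.* n))) (GroupProperties.inverseˡ-unique +-group _ _ (begin
      (4 ℕ.* n) · 1# + n · 1#  ≈⟨ ×-homo-+ 1# (4 ℕ.* n) n ⟨
      (4 ℕ.* n ℕ.+ n) · 1#     ≡⟨ ≡.cong (_· 1#) (≡.trans (ℕ.+-comm (4 ℕ.* n) n) (ℕ.*-comm 5 n)) ⟩
      (n ℕ.* 5) · 1#           ≈⟨ multiple≈0 n ⟩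
      0#                       ∎))

    homomorphism : coefficients -Raw-AlmostCommutative⟶ fromCommutativeRing K
    homomorphism = record
      { ⟦_⟧ = _· 1#
      ; +-homo = λ m n → trans (sym (residue (m ℕ.+ n))) (×-homo-+ 1# m n)
      ; *-homo = λ m n → trans (sym (residue (m ℕ.* n))) (×1-homo-* m n)
      ; -‿homo = -‿homo
      ; 0-homo = refl ; 1-homo = refl }

    compare : ∀ m n → Maybe (m · 1# ≈ n · 1#)
    compare m n with m ℕ.≟ n
    ... | yes eq = just (reflexive (≡.cong (_· 1#) eq))
    ... | no  _  = nothing

  open Solver coefficients (fromCommutativeRing K) homomorphism compare public

-- Gauss's identity in finite form, from the q-binomial series

module GaussIdentity {c ℓ} (K : CommutativeRing c ℓ) (5≈0 : Char5 K) (x : CommutativeRing.Carrier K) where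
  open CommutativeRing K
  private
    module S = Char5Solver K 5≈0
    open S using (_:+_; _:*_; _:-_; :-_; con; _:=_)
    :1 : ∀ {n} → S.Polynomial n
    :1 = con 1
  open SetoidReasoning setoid
  open Exp semiring using (_^_)
  open CExp commutativeSemiring using (^-distrib-*)

  -- The finite products (x; x)_n and (-x; x)_n.
  ⟨x⟩ ⟨-x⟩ : ℕ → Carrier
  ⟨x⟩ zero     = 1#
  ⟨x⟩ (suc n)  = (1# - x ^ suc n) * ⟨x⟩ n
  ⟨-x⟩ zero    = 1#
  ⟨-x⟩ (suc n) = (1# + x ^ suc n) * ⟨-x⟩ n

  -- Σ_{|j| ≤ n} (−1)^j x^{j²}
  theta : ℕ → Carrier
  theta zero    = 1#
  theta (suc n) = theta n + (1# + 1#) * (- x ^ suc n) ^ suc n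

  -- This is (-1)^k (-1; x)_k. For k ≥ 1 its factor 1 + x^0 = 2 becomes the 2 in `theta` that
  -- accounts for ±j.
  sign-coeff : ℕ → Carrier
  sign-coeff zero    = 1#
  sign-coeff (suc k) = - ((1# + x ^ k) * sign-coeff k)

  -- Σ_{k ≤ n} (−1)^k (−1; x)_k (x; x)_n / (x; x)_k z^k, a truncation of the q-binomial series.
  binomial : ℕ → Carrier → Carrier
  binomial zero    z = 1#
  binomial (suc n) z = (1# - x ^ suc n) * binomial n z + sign-coeff (suc n) * z ^ suc n

  -- Without truncation and up to (x; x)_n the series is B(z) = (z; x)_∞ / (-z; x)_∞, for which (1 +
  -- z) B(z) = (1 - z) B(xz). Stopping at z^n leaves the boundary term on the right, the negative of
  -- the first omitted term `sign-coeff (suc n) * z ^ suc n`.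
  binomial-functional-eq : ∀ n z →
    (1# + z) * binomial n z - (1# - z) * binomial n (x * z) ≈ (1# + x ^ n) * sign-coeff n * z ^ suc n
  binomial-functional-eq zero z = S.solve 1
    (λ z → (:1 :+ z) :* :1 :- (:1 :- z) :* :1 := (:1 :+ :1) :* :1 :* (z :* :1)) refl z
  binomial-functional-eq (suc n) z = begin
    (1# + z) * (e * b + s * w) - (1# - z) * (e * b′ + s * (x * z) ^ suc n)
      ≈⟨ +-congˡ (-‿cong (*-congˡ (+-congˡ (*-congˡ (^-distrib-* x z (suc n)))))) ⟩
    (1# + z) * ((1# - y) * b + s * w) - (1# - z) * ((1# - y) * b′ + s * (y * w))
      ≈⟨ S.solve 6 (λ z y b b′ s w →
           (:1 :+ z) :* ((:1 :- y) :* b :+ s :* w) :- (:1 :- z) :* ((:1 :- y) :* b′ :+ s :* (y :* w))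
           := (:1 :- y) :* ((:1 :+ z) :* b :- (:1 :- z) :* b′) :+ s :* w :* ((:1 :+ z) :- (:1 :- z) :* y))
           refl z y b b′ s w ⟩
    (1# - y) * ((1# + z) * b - (1# - z) * b′) + s * w * ((1# + z) - (1# - z) * y)
      ≈⟨ +-congʳ (*-congˡ (binomial-functional-eq n z)) ⟩
    (1# - y) * (t * w) + - t * w * ((1# + z) - (1# - z) * y)
      ≈⟨ S.solve 4 (λ z y t w →
           (:1 :- y) :* (t :* w) :+ (:- t) :* w :* ((:1 :+ z) :- (:1 :- z) :* y)
           := (:1 :+ y) :* (:- t) :* (z :* w)) refl z y t w ⟩
    (1# + y) * - t * (z * w) ∎
    where
    y = x ^ suc n
    e = 1# - y
    b = binomial n z
    b′ = binomial n (x * z)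
    t = (1# + x ^ n) * sign-coeff n
    s = sign-coeff (suc n)
    w = z ^ suc n

  sign-coeff-suc : ∀ n z → sign-coeff (suc n) * z ^ suc n ≈ (1# + 1#) * ⟨-x⟩ n * (- z) ^ suc n
  sign-coeff-suc zero z = S.solve 1 (λ z → (:- ((:1 :+ :1) :* :1)) :* (z :* :1)
    := (:1 :+ :1) :* :1 :* ((:- z) :* :1)) refl z
  sign-coeff-suc (suc n) z = begin
    - ((1# + y) * s) * (z * w)
      ≈⟨ S.solve 4 (λ y s z w → (:- ((:1 :+ y) :* s)) :* (z :* w) := (:1 :+ y) :* (:- z) :* (s :* w)) refl y s z w ⟩
    (1# + y) * - z * (s * w)
      ≈⟨ *-congˡ (sign-coeff-suc n z) ⟩
    (1# + y) * - z * ((1# + 1#) * d * w′)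
      ≈⟨ S.solve 4 (λ y z d w → (:1 :+ y) :* (:- z) :* ((:1 :+ :1) :* d :* w)
           := (:1 :+ :1) :* ((:1 :+ y) :* d) :* ((:- z) :* w)) refl y z d w′ ⟩
    (1# + 1#) * ((1# + y) * d) * (- z * w′) ∎
    where
    y = x ^ suc n
    s = sign-coeff (suc n)
    w = z ^ suc n
    w′ = (- z) ^ suc n
    d = ⟨-x⟩ n

  -- Raising n multiplies the argument y = x^(n+1) by x. The functional equation at z = y applies
  -- because its factor 1 - z is then the factor 1 - y in `binomial (suc n)`; its boundary term and
  -- the new summand combine into the next term of `theta`.
  binomial-theta : ∀ n → binomial n (x ^ suc n) ≈ ⟨-x⟩ n * theta n
  binomial-theta zero    = sym (*-identityˡ _)
  binomial-theta (suc n) = begin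
    (1# - y) * b′ + s * (x * y) ^ suc n
      ≈⟨ +-congˡ (*-congˡ (^-distrib-* x y (suc n))) ⟩
    (1# - y) * b′ + s * (y * w)
      ≈⟨ S.solve 5 (λ y b b′ s w → (:1 :- y) :* b′ :+ s :* (y :* w)
           := (:1 :+ y) :* b :- ((:1 :+ y) :* b :- (:1 :- y) :* b′) :+ y :* (s :* w)) refl y b b′ s w ⟩
    (1# + y) * b - ((1# + y) * b - (1# - y) * b′) + y * (s * w)
      ≈⟨ +-congʳ (+-cong (*-congˡ (binomial-theta n)) (-‿cong (binomial-functional-eq n y))) ⟩
    (1# + y) * (d * θ) - t * w + y * (- t * w)
      ≈⟨ S.solve 5 (λ y d θ t w → (:1 :+ y) :* (d :* θ) :- t :* w :+ y :* ((:- t) :* w)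
           := (:1 :+ y) :* (d :* θ) :+ (:1 :+ y) :* ((:- t) :* w)) refl y d θ t w ⟩
    (1# + y) * (d * θ) + (1# + y) * (s * w)
      ≈⟨ +-congˡ (*-congˡ (sign-coeff-suc n y)) ⟩
    (1# + y) * (d * θ) + (1# + y) * ((1# + 1#) * d * w′)
      ≈⟨ S.solve 4 (λ y d θ w → (:1 :+ y) :* (d :* θ) :+ (:1 :+ y) :* ((:1 :+ :1) :* d :* w)
           := (:1 :+ y) :* d :* (θ :+ (:1 :+ :1) :* w)) refl y d θ w′ ⟩
    (1# + y) * d * (θ + (1# + 1#) * w′) ∎
    where
    y = x ^ suc n
    b = binomial n y
    b′ = binomial n (x * y)
    t = (1# + x ^ n) * sign-coeff n
    s = sign-coeff (suc n)
    w = y ^ suc n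
    w′ = (- y) ^ suc n
    d = ⟨-x⟩ n
    θ = theta n

  -- As a polynomial in z, `binomial n` has constant term (x; x)_n. At z = x^(n+1) with x = -q the
  -- rest is invisible up to degree n, which stands in for letting n tend to infinity.
  binomial≡⟨x⟩ : ∀ n z → ∃ λ r → binomial n z ≈ ⟨x⟩ n + z * r
  binomial≡⟨x⟩ zero    z = 0# , sym (trans (+-congˡ (zeroʳ z)) (+-identityʳ _))
  binomial≡⟨x⟩ (suc n) z with r , eq ← binomial≡⟨x⟩ n z =
    e * r + s * z ^ n ,
    trans (+-congʳ (*-congˡ eq))
      (S.solve 6 (λ e d z r s w → e :* (d :+ z :* r) :+ s :* (z :* w) := e :* d :+ z :* (e :* r :+ s :* w))
        refl e (⟨x⟩ n) z r s (z ^ n))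
    where
    e = 1# - x ^ suc n
    s = sign-coeff (suc n)

  -- Gauss: Σ (−1)^j x^{j²} = (x; x)_∞ / (−x; x)_∞, in a form valid for every n.
  gauss : ∀ n → ∃ λ r → ⟨-x⟩ n * theta n ≈ ⟨x⟩ n + x ^ suc n * r
  gauss n with r , eq ← binomial≡⟨x⟩ n (x ^ suc n) = r , trans (sym (binomial-theta n)) eq

-- Integers modulo 5, represented by natural numbers

infix 4 _≡₅_
record _≡₅_ (m n : ℕ) : Set where
  constructor mod₅
  field residues : m % 5 ≡ n % 5
open _≡₅_

≡⇒≡₅ : ∀ {m n} → m ≡ n → m ≡₅ n
≡⇒≡₅ eq = mod₅ (≡.cong (_% 5) eq)

-- With -1 represented by 4, cardinalities in ℕ are themselves coefficients and need no conversion.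
ℤ/5 : CommutativeRing _ _
ℤ/5 = record
  { Carrier = ℕ ; _≈_ = _≡₅_ ; _+_ = ℕ._+_ ; _*_ = ℕ._*_ ; -_ = 4 ℕ.*_ ; 0# = 0 ; 1# = 1
  ; isCommutativeRing = record
    { isRing = record
      { +-isAbelianGroup = record
        { isGroup = record
          { isMonoid = record
            { isSemigroup = record
              { isMagma = record
                { isEquivalence = record
                  { refl  = mod₅ ≡.refl
                  ; sym   = λ p → mod₅ (≡.sym (residues p))
                  ; trans = λ p q → mod₅ (≡.trans (residues p) (residues q))
                  }
                ; ∙-cong = +-cong₅
                }
              ; assoc = λ a b c → ≡⇒≡₅ (ℕ.+-assoc a b c)
              }
            ; identity = (λ a → ≡⇒≡₅ (ℕ.+-identityˡ a)) , (λ a → ≡⇒≡₅ (ℕ.+-identityʳ a))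
            }
          ; inverse = (λ a → inverse₅ a (ℕ.+-comm (4 ℕ.* a) a)) , (λ a → inverse₅ a ≡.refl)
          ; ⁻¹-cong = λ {a} {b} → *-cong₅ {4} {4} {a} {b} (mod₅ ≡.refl)
          }
        ; comm = λ a b → ≡⇒≡₅ (ℕ.+-comm a b)
        }
      ; *-cong = *-cong₅
      ; *-assoc = λ a b c → ≡⇒≡₅ (ℕ.*-assoc a b c)
      ; *-identity = (λ a → ≡⇒≡₅ (ℕ.*-identityˡ a)) , (λ a → ≡⇒≡₅ (ℕ.*-identityʳ a))
      ; distrib = (λ a b c → ≡⇒≡₅ (ℕ.*-distribˡ-+ a b c)) , (λ a b c → ≡⇒≡₅ (ℕ.*-distribʳ-+ a b c))
      }
    ; *-comm = λ a b → ≡⇒≡₅ (ℕ.*-comm a b)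
    }
  }
  where
  +-cong₅ : ∀ {a b c d} → a ≡₅ b → c ≡₅ d → a ℕ.+ c ≡₅ b ℕ.+ d
  +-cong₅ {a} {b} {c} {d} p q = mod₅ (≡.trans (ℕ.%-distribˡ-+ a c 5)
    (≡.trans (≡.cong₂ (λ x y → (x ℕ.+ y) % 5) (residues p) (residues q)) (≡.sym (ℕ.%-distribˡ-+ b d 5))))
  *-cong₅ : ∀ {a b c d} → a ≡₅ b → c ≡₅ d → a ℕ.* c ≡₅ b ℕ.* d
  *-cong₅ {a} {b} {c} {d} p q = mod₅ (≡.trans (ℕ.%-distribˡ-* a c 5)
    (≡.trans (≡.cong₂ (λ x y → (x ℕ.* y) % 5) (residues p) (residues q)) (≡.sym (ℕ.%-distribˡ-* b d 5))))
  inverse₅ : ∀ a {b} → b ≡ 5 ℕ.* a → b ≡₅ 0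
  inverse₅ a eq = mod₅ (≡.trans (≡.cong (_% 5) (≡.trans eq (ℕ.*-comm 5 a))) (ℕ.m*n%n≡0 a 5))

-- Without repetitions, equality as sets is equality as bags. Bijective counts are obtained from
-- this by comparing a list with the image of another under `map`.
length-set-≡ : ∀ {A : Set} {xs ys : List A} → Unique xs → Unique ys →
               (∀ {v} → v ∈ xs → v ∈ ys) → (∀ {v} → v ∈ ys → v ∈ xs) → length xs ≡ length ys
length-set-≡ uxs uys f g = ↭-length (∼bag⇒↭ (unique∧set⇒bag uxs uys (mk⇔ f g)))

-- Recurrences for overpartitions with bounded parts

module OverpartitionCounts where
  open import Data.Nat using (_+_)
  open ≡ using (refl; cong; cong₂; trans; sym)

  -- Two families, because removing a leading part of size m leaves more than a bound: a further
  -- part of size m must not be overlined. `Follows m` is that condition on the remainder, with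
  -- `part m false` standing for a removed part of either kind.
  Bounded Follows : ℕ → List Part → Set
  Bounded m []      = ⊤
  Bounded m (p ∷ _) = size p ≤ m
  Follows m []      = ⊤
  Follows m (p ∷ _) = part m false ≽ p

  bounded? : ∀ m ps → Dec (Bounded m ps)
  bounded? m []      = yes tt
  bounded? m (p ∷ _) = size p ℕ.≤? m

  follows? : ∀ m ps → Dec (Follows m ps)
  follows? m []      = yes tt
  follows? m (p ∷ _) = part m false ≽? p

  bounded follows : ℕ → ℕ → List (List Part)
  bounded m n = filter (bounded? m) (overpartitions n)
  follows m n = filter (follows? m) (overpartitions n)

  bounded-unique : ∀ m n → Unique (bounded m n)
  bounded-unique m n = filter⁺ (bounded? m) (overpartitions-unique n)

  follows-unique : ∀ m n → Unique (follows m n)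
  follows-unique m n = filter⁺ (follows? m) (overpartitions-unique n)

  ∈-bounded⁺ : ∀ {m n ps} → IsOverpartition n ps → Bounded m ps → ps ∈ bounded m n
  ∈-bounded⁺ {m} {n} {ps} o b = ∈-filter⁺ (bounded? m) (Equivalence.from (∈-overpartitions n ps) o) b

  ∈-bounded⁻ : ∀ {m n ps} → ps ∈ bounded m n → IsOverpartition n ps × Bounded m ps
  ∈-bounded⁻ {m} {n} {ps} i with j , b ← ∈-filter⁻ (bounded? m) {xs = overpartitions n} i =
    Equivalence.to (∈-overpartitions n ps) j , b

  ∈-follows⁺ : ∀ {m n ps} → IsOverpartition n ps → Follows m ps → ps ∈ follows m n
  ∈-follows⁺ {m} {n} {ps} o b = ∈-filter⁺ (follows? m) (Equivalence.from (∈-overpartitions n ps) o) b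

  ∈-follows⁻ : ∀ {m n ps} → ps ∈ follows m n → IsOverpartition n ps × Follows m ps
  ∈-follows⁻ {m} {n} {ps} i with j , b ← ∈-filter⁻ (follows? m) {xs = overpartitions n} i =
    Equivalence.to (∈-overpartitions n ps) j , b

  isOverpartition-∷⁺ : ∀ {s n b ps} → 1 ≤ s → IsOverpartition n ps → Follows s ps →
                       IsOverpartition (s + n) (part s b ∷ ps)
  isOverpartition-∷⁺ {ps = []}    1≤s (pos , _ , eq) f = 1≤s ∷ pos , [-] , cong (_ +_) eq
  isOverpartition-∷⁺ {ps = _ ∷ _} 1≤s (pos , l , eq) f = 1≤s ∷ pos , f ∷ l , cong (_ +_) eq

  isOverpartition-∷⁻ : ∀ {s n b ps} → IsOverpartition (s + n) (part s b ∷ ps) →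
                       IsOverpartition n ps × Follows s ps
  isOverpartition-∷⁻ {s} {ps = []}    (_ ∷ pos , _     , eq) = (pos , [] , ℕ.+-cancelˡ-≡ s _ _ eq) , tt
  isOverpartition-∷⁻ {s} {ps = _ ∷ _} (_ ∷ pos , f ∷ l , eq) = (pos , l  , ℕ.+-cancelˡ-≡ s _ _ eq) , f

  size≤n : ∀ {n p ps} → IsOverpartition n (p ∷ ps) → size p ≤ n
  size≤n {p = p} (_ , _ , refl) = ℕ.m≤m+n (size p) _

  p̄≡bounded : ∀ {m n} → n ≤ m → p̄ n ≡ length (bounded m n)
  p̄≡bounded {m} {n} n≤m = sym (cong length (filter-all (bounded? m)
    (All.tabulate λ {ps} i → all-bounded ps (Equivalence.to (∈-overpartitions n ps) i))))
    where
    all-bounded : ∀ ps → IsOverpartition n ps → Bounded m ps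
    all-bounded []       _ = tt
    all-bounded (p ∷ ps) o = ℕ.≤-trans (size≤n o) n≤m

  bounded-zero : ∀ n → length (bounded 0 (suc n)) ≡ 0
  bounded-zero n = length-set-≡ (bounded-unique 0 (suc n)) [] none (λ ())
    where
    none : ∀ {ps} → ps ∈ bounded 0 (suc n) → ps ∈ []
    none {[]}     i with (_ , _ , ()) , _ ← ∈-bounded⁻ {0} {suc n} i
    none {p ∷ ps} i with (1≤p ∷ _ , _) , p≤0 ← ∈-bounded⁻ {0} {suc n} i = ⊥-elim (ℕ.n≮0 (ℕ.≤-trans 1≤p p≤0))

  Bounded-suc : ∀ {m ps} → Bounded m ps → Bounded (suc m) ps
  Bounded-suc {ps = []}    _ = tt
  Bounded-suc {ps = _ ∷ _} b = ℕ.m≤n⇒m≤1+n b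

  Bounded⇒Follows : ∀ {m ps} → Bounded m ps → Follows (suc m) ps
  Bounded⇒Follows {ps = []}    _ = tt
  Bounded⇒Follows {ps = _ ∷ _} b = inj₁ (s≤s b)

  module _ {m : ℕ} where
    private s = suc m

    Bounded-split : ∀ {ps} → Bounded s ps → Bounded m ps ⊎ ∃ λ b → ∃ λ qs → ps ≡ part s b ∷ qs
    Bounded-split {[]} _ = inj₁ tt
    Bounded-split {part t b ∷ qs} t≤s with ℕ.m≤n⇒m<n∨m≡n t≤s
    ... | inj₁ (s≤s t≤m) = inj₁ t≤m
    ... | inj₂ refl      = inj₂ (b , qs , refl)

    Follows-split : ∀ {ps} → Follows s ps → Bounded m ps ⊎ ∃ λ qs → ps ≡ part s false ∷ qs
    Follows-split {[]} _ = inj₁ tt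
    Follows-split {part t b ∷ qs} (inj₁ (s≤s t≤m)) = inj₁ t≤m
    Follows-split {part t b ∷ qs} (inj₂ (refl , refl)) = inj₂ (qs , refl)

    private
      prepend : Bool → ℕ → List (List Part)
      prepend b k = map (part s b ∷_) (follows s k)

      prepend-unique : ∀ b k → Unique (prepend b k)
      prepend-unique b k = map⁺ ∷-injectiveʳ (follows-unique s k)

      ∈-prepend⁺ : ∀ {b k ps} → IsOverpartition (s + k) (part s b ∷ ps) → part s b ∷ ps ∈ prepend b k
      ∈-prepend⁺ o with o′ , f ← isOverpartition-∷⁻ o = ∈-map⁺ _ (∈-follows⁺ o′ f)

      ∈-prepend⁻ : ∀ {b k ps} → ps ∈ prepend b k →
                   ∃ λ qs → ps ≡ part s b ∷ qs × IsOverpartition (s + k) ps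
      ∈-prepend⁻ {b} {k} i with qs , j , refl ← ∈-map⁻ (part s b ∷_) i with o , f ← ∈-follows⁻ {s} {k} j =
        qs , refl , isOverpartition-∷⁺ (s≤s z≤n) o f

      bounded-prepend : ∀ {b k n} → Disjoint (bounded m n) (prepend b k)
      bounded-prepend {b} {k} {n} (i , j) with _ , refl , _ ← ∈-prepend⁻ {b} {k} j =
        ℕ.1+n≰n (proj₂ (∈-bounded⁻ {m} {n} i))

    follows-< : ∀ {n} → n < s → length (follows s n) ≡ length (bounded m n)
    follows-< {n} n<s = length-set-≡ (follows-unique s n) (bounded-unique m n) to from
      where
      to : ∀ {ps} → ps ∈ follows s n → ps ∈ bounded m n
      to {ps} i with o , f ← ∈-follows⁻ {s} {n} i with Follows-split {ps} f
      ... | inj₁ b          = ∈-bounded⁺ o b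
      ... | inj₂ (_ , refl) = ⊥-elim (ℕ.<⇒≱ n<s (size≤n o))
      from : ∀ {ps} → ps ∈ bounded m n → ps ∈ follows s n
      from {ps} i with o , b ← ∈-bounded⁻ {m} {n} i = ∈-follows⁺ o (Bounded⇒Follows {ps = ps} b)

    bounded-< : ∀ {n} → n < s → length (bounded s n) ≡ length (bounded m n)
    bounded-< {n} n<s = length-set-≡ (bounded-unique s n) (bounded-unique m n) to from
      where
      to : ∀ {ps} → ps ∈ bounded s n → ps ∈ bounded m n
      to {ps} i with o , f ← ∈-bounded⁻ {s} {n} i with Bounded-split {ps} f
      ... | inj₁ b              = ∈-bounded⁺ o b
      ... | inj₂ (_ , _ , refl) = ⊥-elim (ℕ.<⇒≱ n<s (size≤n o))
      from : ∀ {ps} → ps ∈ bounded m n → ps ∈ bounded s n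
      from {ps} i with o , b ← ∈-bounded⁻ {m} {n} i = ∈-bounded⁺ o (Bounded-suc {ps = ps} b)

    -- Sorted by the leading part: either it is smaller than `s`, or it is a plain `s` whose removal
    -- leaves a list of the same family. This recursion encodes the factor 1/(1 - q^s).
    follows-+ : ∀ k → length (follows s (s + k)) ≡ length (bounded m (s + k)) + length (follows s k)
    follows-+ k = trans
      (length-set-≡ (follows-unique s n) (++⁺ (bounded-unique m n) (prepend-unique false k) (bounded-prepend {false} {k} {n})) to from)
      (trans (length-++ (bounded m n)) (cong (length (bounded m n) +_) (length-map _ (follows s k))))
      where
      n = s + k
      to : ∀ {ps} → ps ∈ follows s n → ps ∈ bounded m n ++ prepend false k
      to {ps} i with o , f ← ∈-follows⁻ {s} {n} i with Follows-split {ps} f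
      ... | inj₁ b          = ∈-++⁺ˡ (∈-bounded⁺ o b)
      ... | inj₂ (_ , refl) = ∈-++⁺ʳ (bounded m n) (∈-prepend⁺ o)
      from : ∀ {ps} → ps ∈ bounded m n ++ prepend false k → ps ∈ follows s n
      from {ps} i with ∈-++⁻ (bounded m n) i
      ... | inj₁ j with o , b ← ∈-bounded⁻ {m} {n} j = ∈-follows⁺ o (Bounded⇒Follows {ps = ps} b)
      from {ps} i | inj₂ j with _ , refl , o ← ∈-prepend⁻ {false} {k} j = ∈-follows⁺ o (inj₂ (refl , refl))

    -- A leading `s` may now be plain or overlined, with the same remainders in both cases, hence
    -- the doubled summand.
    bounded-+ : ∀ k → length (bounded s (s + k)) ≡
                      length (bounded m (s + k)) + (length (follows s k) + length (follows s k))
    bounded-+ k = trans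
      (length-set-≡ (bounded-unique s n)
        (++⁺ (bounded-unique m n) (++⁺ (prepend-unique false k) (prepend-unique true k) disjoint) disjoint′) to from)
      (trans (length-++ (bounded m n)) (cong (length (bounded m n) +_)
        (trans (length-++ (prepend false k)) (cong₂ _+_ (length-map _ (follows s k)) (length-map _ (follows s k))))))
      where
      n = s + k
      disjoint : Disjoint (prepend false k) (prepend true k)
      disjoint (i , j) with _ , refl , _ ← ∈-prepend⁻ {false} {k} i | _ , () , _ ← ∈-prepend⁻ {true} {k} j
      disjoint′ : Disjoint (bounded m n) (prepend false k ++ prepend true k)
      disjoint′ (i , j) with ∈-++⁻ (prepend false k) j
      ... | inj₁ j′ = bounded-prepend {false} {k} {n} (i , j′)
      ... | inj₂ j′ = bounded-prepend {true} {k} {n} (i , j′)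
      to : ∀ {ps} → ps ∈ bounded s n → ps ∈ bounded m n ++ (prepend false k ++ prepend true k)
      to {ps} i with o , f ← ∈-bounded⁻ {s} {n} i with Bounded-split {ps} f
      ... | inj₁ b                  = ∈-++⁺ˡ (∈-bounded⁺ o b)
      ... | inj₂ (false , _ , refl) = ∈-++⁺ʳ (bounded m n) (∈-++⁺ˡ (∈-prepend⁺ o))
      ... | inj₂ (true , _ , refl)  = ∈-++⁺ʳ (bounded m n) (∈-++⁺ʳ (prepend false k) (∈-prepend⁺ o))
      prepended : ∀ {b ps} → ps ∈ prepend b k → ps ∈ bounded s n
      prepended {b} j with _ , refl , o ← ∈-prepend⁻ {b} {k} j = ∈-bounded⁺ o ℕ.≤-refl
      from : ∀ {ps} → ps ∈ bounded m n ++ (prepend false k ++ prepend true k) → ps ∈ bounded s n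
      from {ps} i with ∈-++⁻ (bounded m n) i
      ... | inj₁ j with o , b ← ∈-bounded⁻ {m} {n} j = ∈-bounded⁺ o (Bounded-suc {ps = ps} b)
      from {ps} i | inj₂ j with ∈-++⁻ (prepend false k) j
      ... | inj₁ j′ = prepended j′
      ... | inj₂ j′ = prepended j′

-- Squares and sums of two squares at multiples of 5

module SumsOfSquares where
  open import Data.Integer using (+_; -[1+_])
  open import Data.Nat using (_+_; _*_)
  open ≡ using (refl; cong; cong₂; trans; sym; subst; module ≡-Reasoning)

  -- Ordered so that each step prepends the pair ±(N + 1), matching one summand of `theta`.
  box : ℕ → List ℤ
  box zero    = + 0 ∷ []
  box (suc N) = + suc N ∷ -[1+ N ] ∷ box N

  ∈-box⁺ : ∀ N x → ∣ x ∣ ≤ N → x ∈ box N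
  ∈-box⁺ zero    (+ zero) z≤n = here refl
  ∈-box⁺ (suc N) x ∣x∣≤ with ℕ.m≤n⇒m<n∨m≡n ∣x∣≤
  ∈-box⁺ (suc N) x        _ | inj₁ (s≤s ∣x∣≤N) = there (there (∈-box⁺ N x ∣x∣≤N))
  ∈-box⁺ (suc N) (+ _)    _ | inj₂ refl = here refl
  ∈-box⁺ (suc N) -[1+ _ ] _ | inj₂ refl = there (here refl)

  ∈-box⁻ : ∀ N {x} → x ∈ box N → ∣ x ∣ ≤ N
  ∈-box⁻ zero    (here refl)         = z≤n
  ∈-box⁻ (suc N) (here refl)         = ℕ.≤-refl
  ∈-box⁻ (suc N) (there (here refl)) = ℕ.≤-refl
  ∈-box⁻ (suc N) (there (there i))   = ℕ.m≤n⇒m≤1+n (∈-box⁻ N i)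

  box-unique : ∀ N → Unique (box N)
  box-unique zero    = [] ∷ []
  box-unique (suc N) = ((λ ()) ∷ All.tabulate (outside refl)) ∷ All.tabulate (outside refl) ∷ box-unique N
    where
    outside : ∀ {x y} → ∣ x ∣ ≡ suc N → y ∈ box N → x ≢ y
    outside eq i refl = ℕ.1+n≰n (subst (_≤ N) eq (∈-box⁻ N i))

  sq : ℤ → ℕ
  sq x = ∣ x ∣ * ∣ x ∣

  norm : ℤ × ℤ → ℕ
  norm (x , y) = sq x + sq y

  ∣x∣≤sq : ∀ x → ∣ x ∣ ≤ sq x
  ∣x∣≤sq x with ∣ x ∣
  ... | zero  = z≤n
  ... | suc n = ℕ.m≤m*n (suc n) (suc n)

  sq-ℤ : ∀ x → + sq x ≡ x ℤ.* x
  sq-ℤ (+ n)    = ℤ.pos-* n n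
  sq-ℤ -[1+ n ] = refl

  norm-ℤ : ∀ x y → + norm (x , y) ≡ x ℤ.* x ℤ.+ y ℤ.* y
  norm-ℤ x y = trans (ℤ.pos-+ (sq x) (sq y)) (cong₂ ℤ._+_ (sq-ℤ x) (sq-ℤ y))

  opaque
    -- The range `N` is separate from the value `n`, so that a single finite box yields all
    -- coefficients up to degree `N`.
    rootsIn : ℕ → ℕ → List ℤ
    rootsIn N n = filter (λ x → sq x ℕ.≟ n) (box N)

    pointsIn : ℕ → ℕ → List (ℤ × ℤ)
    pointsIn N n = filter (λ p → norm p ℕ.≟ n) (cartesianProduct (box N) (box N))

  roots : ℕ → List ℤ
  roots n = rootsIn n n

  points : ℕ → List (ℤ × ℤ)
  points n = pointsIn n n

  opaque
    unfolding rootsIn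

    ∈-rootsIn⁺ : ∀ {N n x} → n ≤ N → sq x ≡ n → x ∈ rootsIn N n
    ∈-rootsIn⁺ {N} {x = x} n≤N refl = ∈-filter⁺ _ (∈-box⁺ N x (ℕ.≤-trans (∣x∣≤sq x) n≤N)) refl

    ∈-rootsIn⁻ : ∀ {N n x} → x ∈ rootsIn N n → sq x ≡ n
    ∈-rootsIn⁻ {N} {n} i = proj₂ (∈-filter⁻ (λ x → sq x ℕ.≟ n) {xs = box N} i)

    rootsIn-unique : ∀ N n → Unique (rootsIn N n)
    rootsIn-unique N n = filter⁺ _ (box-unique N)

  rootsIn-length : ∀ {N n} → n ≤ N → length (rootsIn N n) ≡ length (roots n)
  rootsIn-length {N} {n} n≤N = length-set-≡ (rootsIn-unique N n) (rootsIn-unique n n)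
    (λ i → ∈-rootsIn⁺ ℕ.≤-refl (∈-rootsIn⁻ {N} i)) (λ i → ∈-rootsIn⁺ n≤N (∈-rootsIn⁻ {n} i))

  opaque
    unfolding pointsIn

    ∈-points⁺ : ∀ {n p} → norm p ≡ n → p ∈ points n
    ∈-points⁺ {n} {x , y} refl = ∈-filter⁺ _
      (∈-cartesianProduct⁺ (∈-box⁺ n x (ℕ.≤-trans (∣x∣≤sq x) (ℕ.m≤m+n _ _)))
                           (∈-box⁺ n y (ℕ.≤-trans (∣x∣≤sq y) (ℕ.m≤n+m _ _)))) refl

    ∈-points⁻ : ∀ {n p} → p ∈ points n → norm p ≡ n
    ∈-points⁻ {n} i = proj₂ (∈-filter⁻ (λ p → norm p ℕ.≟ n) {xs = cartesianProduct (box n) (box n)} i)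

    points-unique : ∀ n → Unique (points n)
    points-unique n = filter⁺ _ (cartesianProduct⁺ (box-unique n) (box-unique n))

  5∣_ : ℤ → Set
  5∣ x = + 5 ℤ∣.∣ x

  opaque
    5∣?_ : ∀ x → Dec (5∣ x)
    5∣? x = + 5 ℤ∣.∣? x

  prime-5 : Prime 5
  prime-5 = from-yes (prime? 5)

  5∣-euclid : ∀ x y → 5∣ (x ℤ.* y) → 5∣ x ⊎ 5∣ y
  5∣-euclid x y d with euclidsLemma ∣ x ∣ ∣ y ∣ prime-5 (subst (5 ℕ.∣_) (ℤ.abs-* x y) (ℤ∣.∣⇒∣ᵤ d))
  ... | inj₁ e = inj₁ (ℤ∣.∣ᵤ⇒∣ e)
  ... | inj₂ e = inj₂ (ℤ∣.∣ᵤ⇒∣ e)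

  -- Inclusion and exclusion for two properties that cover the list, kept additive to stay in ℕ.
  length-filter-∪∩ : ∀ {A : Set} {P Q : A → Set} (P? : ∀ x → Dec (P x)) (Q? : ∀ x → Dec (Q x)) xs →
    (∀ {x} → x ∈ xs → P x ⊎ Q x) →
    length xs + length (filter (λ x → P? x ×-dec Q? x) xs) ≡ length (filter P? xs) + length (filter Q? xs)
  length-filter-∪∩ P? Q? []       cover = refl
  length-filter-∪∩ P? Q? (x ∷ xs) cover
    with ih ← length-filter-∪∩ P? Q? xs (λ i → cover (there i)) with P? x | Q? x
  ... | yes _ | yes _ = cong suc (trans (ℕ.+-suc _ _) (trans (cong suc ih) (sym (ℕ.+-suc _ _))))
  ... | yes _ | no  _ = cong suc ih
  ... | no  _ | yes _ = trans (cong suc ih) (sym (ℕ.+-suc _ _))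
  ... | no ¬p | no ¬q with cover (here refl)
  ... | inj₁ p = ⊥-elim (¬p p)
  ... | inj₂ q = ⊥-elim (¬q q)

  -- For e = ±1 this is multiplication by 2 − i, followed by conjugation when e = −1.
  rotate : ℤ → ℤ × ℤ → ℤ × ℤ
  rotate e (x , y) = + 2 ℤ.* x ℤ.+ y , e ℤ.* (+ 2 ℤ.* y ℤ.- x)

  -- Modulo 2 - ei, with e = ±1, the Gaussian integers become ℤ/5 with i = 2e. So this is
  -- divisibility of a + bi by 2 - ei.
  Aligned : ℤ → ℤ × ℤ → Set
  Aligned e (a , b) = 5∣ (a ℤ.+ + 2 ℤ.* (e ℤ.* b))

  opaque
    aligned? : ∀ e p → Dec (Aligned e p)
    aligned? e (a , b) = 5∣? (a ℤ.+ + 2 ℤ.* (e ℤ.* b))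

  module _ (e : ℤ) (e²≡1 : e ℤ.* e ≡ + 1) where

    rotate-aligned : ∀ p → Aligned e (rotate e p)
    rotate-aligned (x , y) = divides y (trans (lem e x y) (trans (cong (λ u → + 2 ℤ.* x ℤ.+ y ℤ.+ + 2 ℤ.* (u ℤ.* (+ 2 ℤ.* y ℤ.- x))) e²≡1) (lem′ x y)))
      where
      lem : ∀ e x y → + 2 ℤ.* x ℤ.+ y ℤ.+ + 2 ℤ.* (e ℤ.* (e ℤ.* (+ 2 ℤ.* y ℤ.- x)))
                    ≡ + 2 ℤ.* x ℤ.+ y ℤ.+ + 2 ℤ.* (e ℤ.* e ℤ.* (+ 2 ℤ.* y ℤ.- x))
      lem = solve-∀
      lem′ : ∀ x y → + 2 ℤ.* x ℤ.+ y ℤ.+ + 2 ℤ.* (+ 1 ℤ.* (+ 2 ℤ.* y ℤ.- x)) ≡ y ℤ.* + 5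
      lem′ = solve-∀

    rotate-norm : ∀ p → norm (rotate e p) ≡ norm p * 5
    rotate-norm (x , y) = ℤ.+-injective (begin
      + norm (rotate e (x , y))          ≡⟨ norm-ℤ a (e ℤ.* b) ⟩
      a ℤ.* a ℤ.+ e ℤ.* b ℤ.* (e ℤ.* b)  ≡⟨ lem e a b ⟩
      a ℤ.* a ℤ.+ e ℤ.* e ℤ.* (b ℤ.* b)  ≡⟨ cong (λ u → a ℤ.* a ℤ.+ u ℤ.* (b ℤ.* b)) e²≡1 ⟩
      a ℤ.* a ℤ.+ + 1 ℤ.* (b ℤ.* b)      ≡⟨ lem′ x y ⟩
      (x ℤ.* x ℤ.+ y ℤ.* y) ℤ.* + 5      ≡⟨ cong (ℤ._* + 5) (norm-ℤ x y) ⟨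
      + norm (x , y) ℤ.* + 5             ≡⟨ ℤ.pos-* (norm (x , y)) 5 ⟨
      + (norm (x , y) * 5)               ∎)
      where
      open ≡-Reasoning
      a = + 2 ℤ.* x ℤ.+ y
      b = + 2 ℤ.* y ℤ.- x
      lem : ∀ e a b → a ℤ.* a ℤ.+ e ℤ.* b ℤ.* (e ℤ.* b) ≡ a ℤ.* a ℤ.+ e ℤ.* e ℤ.* (b ℤ.* b)
      lem = solve-∀
      lem′ : ∀ x y → (+ 2 ℤ.* x ℤ.+ y) ℤ.* (+ 2 ℤ.* x ℤ.+ y) ℤ.+ + 1 ℤ.* ((+ 2 ℤ.* y ℤ.- x) ℤ.* (+ 2 ℤ.* y ℤ.- x))
                   ≡ (x ℤ.* x ℤ.+ y ℤ.* y) ℤ.* + 5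
      lem′ = solve-∀

    unrotate : ∀ p → Aligned e p → ∃ λ q → p ≡ rotate e q
    -- As `rotate-aligned` shows, the quotient by 5 is the second coordinate of the preimage; the
    -- first follows from e b = 2y - x.
    unrotate (a , b) (divides k eq) = (+ 2 ℤ.* k ℤ.- e ℤ.* b , k) , cong₂ _,_
      (trans (lem₁ a (e ℤ.* b)) (trans (cong (ℤ._- + 2 ℤ.* (e ℤ.* b)) eq) (lem₂ k (e ℤ.* b))))
      (trans (sym (ℤ.*-identityˡ b)) (trans (cong (ℤ._* b) (sym e²≡1)) (lem₃ e k b)))
      where
      lem₁ : ∀ a c → a ≡ a ℤ.+ + 2 ℤ.* c ℤ.- + 2 ℤ.* c
      lem₁ = solve-∀
      lem₂ : ∀ k c → k ℤ.* + 5 ℤ.- + 2 ℤ.* c ≡ + 2 ℤ.* (+ 2 ℤ.* k ℤ.- c) ℤ.+ k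
      lem₂ = solve-∀
      lem₃ : ∀ e k b → e ℤ.* e ℤ.* b ≡ e ℤ.* (+ 2 ℤ.* k ℤ.- (+ 2 ℤ.* k ℤ.- e ℤ.* b))
      lem₃ = solve-∀

    rotate-injective : ∀ {p q} → rotate e p ≡ rotate e q → p ≡ q
    rotate-injective {x , y} {x′ , y′} eq = cong₂ _,_ x≡x′ y≡y′
      where
      open ≡-Reasoning
      a≡ : + 2 ℤ.* x ℤ.+ y ≡ + 2 ℤ.* x′ ℤ.+ y′
      a≡ = cong proj₁ eq
      y≡y′ : y ≡ y′
      y≡y′ = ℤ.*-cancelʳ-≡ y y′ (+ 5) (begin
        y ℤ.* + 5                     ≡⟨ ℤ∣._∣_.equality (rotate-aligned (x , y)) ⟨
        aligned (rotate e (x , y))    ≡⟨ cong aligned eq ⟩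
        aligned (rotate e (x′ , y′))  ≡⟨ ℤ∣._∣_.equality (rotate-aligned (x′ , y′)) ⟩
        y′ ℤ.* + 5                    ∎)
        where
        aligned : ℤ × ℤ → ℤ
        aligned (a , b) = a ℤ.+ + 2 ℤ.* (e ℤ.* b)
      x≡x′ : x ≡ x′
      x≡x′ = ℤ.*-cancelˡ-≡ (+ 2) x x′ (begin
        + 2 ℤ.* x                 ≡⟨ lem x y ⟩
        + 2 ℤ.* x ℤ.+ y ℤ.- y     ≡⟨ cong₂ ℤ._-_ a≡ y≡y′ ⟩
        + 2 ℤ.* x′ ℤ.+ y′ ℤ.- y′  ≡⟨ lem x′ y′ ⟨
        + 2 ℤ.* x′                ∎)
        where
        lem : ∀ x y → + 2 ℤ.* x ≡ + 2 ℤ.* x ℤ.+ y ℤ.- y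
        lem = solve-∀

    -- `rotate e` multiplies norms by 5, is injective, and has exactly the aligned points as its
    -- image.
    length-aligned : ∀ n → length (filter (aligned? e) (points (n * 5))) ≡ length (points n)
    length-aligned n = trans
      (length-set-≡ (filter⁺ (aligned? e) (points-unique (n * 5))) (map⁺ (λ {p} {q} → rotate-injective {p} {q}) (points-unique n)) to from)
      (length-map (rotate e) (points n))
      where
      to : ∀ {p} → p ∈ filter (aligned? e) (points (n * 5)) → p ∈ map (rotate e) (points n)
      to {p} i with j , al ← ∈-filter⁻ (aligned? e) {xs = points (n * 5)} i with q , refl ← unrotate p al =
        ∈-map⁺ (rotate e) (∈-points⁺ {p = q} (ℕ.*-cancelʳ-≡ (norm q) n 5
          (trans (sym (rotate-norm q)) (∈-points⁻ {n * 5} j))))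
      from : ∀ {p} → p ∈ map (rotate e) (points n) → p ∈ filter (aligned? e) (points (n * 5))
      from i with q , j , refl ← ∈-map⁻ (rotate e) i = ∈-filter⁺ (aligned? e)
        (∈-points⁺ {p = rotate e q} (trans (rotate-norm q) (cong (_* 5) (∈-points⁻ {n} j)))) (rotate-aligned q)

  -- (a + 2b)(a - 2b) = a² + b² - 5b² is divisible by the prime 5 as soon as the norm is.
  aligned-cover : ∀ {n p} → p ∈ points (n * 5) → Aligned (+ 1) p ⊎ Aligned (ℤ.- + 1) p
  aligned-cover {n} {a , b} i = 5∣-euclid _ _ (divides (+ n ℤ.- b ℤ.* b) (begin
    (a ℤ.+ + 2 ℤ.* (+ 1 ℤ.* b)) ℤ.* (a ℤ.+ + 2 ℤ.* (ℤ.- + 1 ℤ.* b))  ≡⟨ lem a b ⟩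
    a ℤ.* a ℤ.+ b ℤ.* b ℤ.- b ℤ.* b ℤ.* + 5                          ≡⟨ cong (ℤ._- b ℤ.* b ℤ.* + 5) (norm-ℤ a b) ⟨
    + norm (a , b) ℤ.- b ℤ.* b ℤ.* + 5                               ≡⟨ cong (λ m → + m ℤ.- b ℤ.* b ℤ.* + 5) (∈-points⁻ {n * 5} i) ⟩
    + (n * 5) ℤ.- b ℤ.* b ℤ.* + 5                                    ≡⟨ cong (ℤ._- b ℤ.* b ℤ.* + 5) (ℤ.pos-* n 5) ⟩
    + n ℤ.* + 5 ℤ.- b ℤ.* b ℤ.* + 5                                  ≡⟨ lem′ (+ n) (b ℤ.* b) ⟩
    (+ n ℤ.- b ℤ.* b) ℤ.* + 5                                        ∎))
    where
    open ≡-Reasoning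
    lem : ∀ a b → (a ℤ.+ + 2 ℤ.* (+ 1 ℤ.* b)) ℤ.* (a ℤ.+ + 2 ℤ.* (ℤ.- + 1 ℤ.* b)) ≡ a ℤ.* a ℤ.+ b ℤ.* b ℤ.- b ℤ.* b ℤ.* + 5
    lem = solve-∀
    lem′ : ∀ n c → n ℤ.* + 5 ℤ.- c ℤ.* + 5 ≡ (n ℤ.- c) ℤ.* + 5
    lem′ = solve-∀

  scale : ℤ × ℤ → ℤ × ℤ
  scale (x , y) = x ℤ.* + 5 , y ℤ.* + 5

  sq-scale : ∀ x → sq (x ℤ.* + 5) ≡ sq x * 5 * 5
  sq-scale x = ℤ.+-injective (begin
    + sq (x ℤ.* + 5)             ≡⟨ sq-ℤ (x ℤ.* + 5) ⟩
    (x ℤ.* + 5) ℤ.* (x ℤ.* + 5)  ≡⟨ lem x ⟩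
    x ℤ.* x ℤ.* + 5 ℤ.* + 5      ≡⟨ cong (λ u → u ℤ.* + 5 ℤ.* + 5) (sq-ℤ x) ⟨
    + sq x ℤ.* + 5 ℤ.* + 5       ≡⟨ cong (ℤ._* + 5) (ℤ.pos-* (sq x) 5) ⟨
    + (sq x * 5) ℤ.* + 5         ≡⟨ ℤ.pos-* (sq x * 5) 5 ⟨
    + (sq x * 5 * 5)             ∎)
    where
    open ≡-Reasoning
    lem : ∀ x → (x ℤ.* + 5) ℤ.* (x ℤ.* + 5) ≡ x ℤ.* x ℤ.* + 5 ℤ.* + 5
    lem = solve-∀

  norm-scale : ∀ p → norm (scale p) ≡ norm p * 5 * 5
  norm-scale (x , y) = trans (cong₂ _+_ (sq-scale x) (sq-scale y))
    (trans (sym (ℕ.*-distribʳ-+ 5 (sq x * 5) (sq y * 5))) (cong (_* 5) (sym (ℕ.*-distribʳ-+ 5 (sq x) (sq y)))))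

  scale-injective : ∀ {p q} → scale p ≡ scale q → p ≡ q
  scale-injective {x , y} {x′ , y′} eq = cong₂ _,_
    (ℤ.*-cancelʳ-≡ x x′ (+ 5) (cong proj₁ eq)) (ℤ.*-cancelʳ-≡ y y′ (+ 5) (cong proj₂ eq))

  -- Divisible by both 2 - i and 2 + i, hence by 5.
  Doubly : ℤ × ℤ → Set
  Doubly p = Aligned (+ 1) p × Aligned (ℤ.- + 1) p

  opaque
    doubly? : ∀ p → Dec (Doubly p)
    doubly? p = aligned? (+ 1) p ×-dec aligned? (ℤ.- + 1) p

  doubly-scale : ∀ q → Doubly (scale q)
  doubly-scale (x , y) = divides (x ℤ.+ + 2 ℤ.* (+ 1 ℤ.* y)) (lem (+ 1) x y) , divides (x ℤ.+ + 2 ℤ.* (ℤ.- + 1 ℤ.* y)) (lem (ℤ.- + 1) x y)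
    where
    lem : ∀ e x y → x ℤ.* + 5 ℤ.+ + 2 ℤ.* (e ℤ.* (y ℤ.* + 5)) ≡ (x ℤ.+ + 2 ℤ.* (e ℤ.* y)) ℤ.* + 5
    lem = solve-∀

  doubly-unscale : ∀ p → Doubly p → ∃ λ q → p ≡ scale q
  -- Sum and difference give 2a = 5(k + l) and 4b = 5(k - l); the quotients then come from a = 5a -
  -- 4a and b = 5b - 4b.
  doubly-unscale (a , b) (divides k u , divides l v) = (a ℤ.- + 2 ℤ.* (k ℤ.+ l) , b ℤ.- (k ℤ.- l)) , cong₂ _,_
    (trans (lem-a a b) (trans (cong₂ (λ s t → a ℤ.* + 5 ℤ.- + 2 ℤ.* (s ℤ.+ t)) u v) (lem-a′ a k l)))
    (trans (lem-b a b) (trans (cong₂ (λ s t → b ℤ.* + 5 ℤ.- (s ℤ.- t)) u v) (lem-b′ b k l)))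
    where
    lem-a : ∀ a b → a ≡ a ℤ.* + 5 ℤ.- + 2 ℤ.* ((a ℤ.+ + 2 ℤ.* (+ 1 ℤ.* b)) ℤ.+ (a ℤ.+ + 2 ℤ.* (ℤ.- + 1 ℤ.* b)))
    lem-a = solve-∀
    lem-a′ : ∀ a k l → a ℤ.* + 5 ℤ.- + 2 ℤ.* (k ℤ.* + 5 ℤ.+ l ℤ.* + 5) ≡ (a ℤ.- + 2 ℤ.* (k ℤ.+ l)) ℤ.* + 5
    lem-a′ = solve-∀
    lem-b : ∀ a b → b ≡ b ℤ.* + 5 ℤ.- ((a ℤ.+ + 2 ℤ.* (+ 1 ℤ.* b)) ℤ.- (a ℤ.+ + 2 ℤ.* (ℤ.- + 1 ℤ.* b)))
    lem-b = solve-∀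
    lem-b′ : ∀ b k l → b ℤ.* + 5 ℤ.- (k ℤ.* + 5 ℤ.- l ℤ.* + 5) ≡ (b ℤ.- (k ℤ.- l)) ℤ.* + 5
    lem-b′ = solve-∀

  opaque
    unfolding doubly?

    -- The two aligned classes cover the points of norm 5n, each is a rotated copy of the points of
    -- norm n, and their overlap consists of the doubly aligned points.
    points-×5 : ∀ n → length (points (n * 5)) + length (filter doubly? (points (n * 5)))
                      ≡ length (points n) + length (points n)
    points-×5 n = trans (length-filter-∪∩ (aligned? (+ 1)) (aligned? (ℤ.- + 1)) (points (n * 5)) (aligned-cover {n}))
      (cong₂ _+_ (length-aligned (+ 1) refl n) (length-aligned (ℤ.- + 1) refl n))

  doubly-norm : ∀ {n p} → p ∈ filter doubly? (points (n * 5)) → ∃ λ q → p ≡ scale q × n ≡ norm q * 5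
  doubly-norm {n} {p} i with j , d ← ∈-filter⁻ doubly? {xs = points (n * 5)} i with q , refl ← doubly-unscale p d =
    q , refl , ℕ.*-cancelʳ-≡ n (norm q * 5) 5 (trans (sym (∈-points⁻ {n * 5} j)) (norm-scale q))

  doubly-×5 : ∀ m → length (filter doubly? (points (m * 5 * 5))) ≡ length (points m)
  doubly-×5 m = trans
    (length-set-≡ (filter⁺ doubly? (points-unique (m * 5 * 5))) (map⁺ (λ {p} {q} → scale-injective {p} {q}) (points-unique m)) to from)
    (length-map scale (points m))
    where
    to : ∀ {p} → p ∈ filter doubly? (points (m * 5 * 5)) → p ∈ map scale (points m)
    to i = go (doubly-norm {m * 5} i)
      where
      go : ∀ {p} → (∃ λ q → p ≡ scale q × m * 5 ≡ norm q * 5) → p ∈ map scale (points m)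
      go (q , refl , eq) = ∈-map⁺ scale (∈-points⁺ {p = q} (sym (ℕ.*-cancelʳ-≡ m (norm q) 5 eq)))
    from : ∀ {p} → p ∈ map scale (points m) → p ∈ filter doubly? (points (m * 5 * 5))
    from i with q , j , refl ← ∈-map⁻ scale i = ∈-filter⁺ doubly?
      (∈-points⁺ {p = scale q} (trans (norm-scale q) (cong (λ k → k * 5 * 5) (∈-points⁻ {m} j)))) (doubly-scale q)

  length-empty : ∀ {A : Set} (xs : List A) → (∀ {x} → ¬ (x ∈ xs)) → length xs ≡ 0
  length-empty []      _    = refl
  length-empty (_ ∷ _) none = ⊥-elim (none (here refl))

  doubly-≢0 : ∀ n → n % 5 ≢ 0 → length (filter doubly? (points (n * 5))) ≡ 0
  doubly-≢0 n n≢0 = length-empty _ none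
    where
    none : ∀ {p} → ¬ (p ∈ filter doubly? (points (n * 5)))
    none i = let q , _ , eq = doubly-norm {n} i in n≢0 (trans (cong (_% 5) eq) (ℕ.m*n%n≡0 (norm q) 5))

  -- If 5 divides x² it divides x, so 25 divides x². On series this becomes `U₅-φ`.
  root-×5 : ∀ {n x} → sq x ≡ n * 5 → ∃ λ y → x ≡ y ℤ.* + 5 × n ≡ sq y * 5
  root-×5 {n} {x} eq with reduce (euclidsLemma ∣ x ∣ ∣ x ∣ prime-5 (ℕ.divides n eq))
  ... | d with ℤ∣.∣ᵤ⇒∣ {+ 5} {x} d
  ... | divides y refl = y , refl , ℕ.*-cancelʳ-≡ n (sq y * 5) 5 (trans (sym eq) (sq-scale y))

  roots-×25 : ∀ m → length (roots (m * 5 * 5)) ≡ length (roots m)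
  roots-×25 m = trans
    (length-set-≡ (rootsIn-unique (m * 5 * 5) (m * 5 * 5)) (map⁺ (λ {x} {y} → ℤ.*-cancelʳ-≡ x y (+ 5)) (rootsIn-unique m m)) to from)
    (length-map (ℤ._* + 5) (roots m))
    where
    to : ∀ {x} → x ∈ roots (m * 5 * 5) → x ∈ map (ℤ._* + 5) (roots m)
    to {x} i = go (root-×5 {m * 5} {x} (∈-rootsIn⁻ {m * 5 * 5} i))
      where
      go : ∀ {x} → (∃ λ y → x ≡ y ℤ.* + 5 × m * 5 ≡ sq y * 5) → x ∈ map (ℤ._* + 5) (roots m)
      go (y , refl , eq) = ∈-map⁺ (ℤ._* + 5) (∈-rootsIn⁺ {x = y} ℕ.≤-refl (sym (ℕ.*-cancelʳ-≡ m (sq y) 5 eq)))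
    from : ∀ {x} → x ∈ map (ℤ._* + 5) (roots m) → x ∈ roots (m * 5 * 5)
    from i with y , j , refl ← ∈-map⁻ (ℤ._* + 5) i =
      ∈-rootsIn⁺ {x = y ℤ.* + 5} ℕ.≤-refl (trans (sq-scale y) (cong (λ k → k * 5 * 5) (∈-rootsIn⁻ {m} j)))

  roots-×5-≢0 : ∀ m → m % 5 ≢ 0 → length (roots (m * 5)) ≡ 0
  roots-×5-≢0 m m≢0 = length-empty _ none
    where
    none : ∀ {x} → ¬ (x ∈ roots (m * 5))
    none {x} i = let y , _ , eq = root-×5 {m} {x} (∈-rootsIn⁻ {m * 5} i)
                 in m≢0 (trans (cong (_% 5) eq) (ℕ.m*n%n≡0 (sq y) 5))

  -- 2 and 3 are not squares modulo 5, which is why `φ` has only three components.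
  roots-nonresidue : ∀ n → n % 5 ≡ 2 ⊎ n % 5 ≡ 3 → length (roots n) ≡ 0
  roots-nonresidue n n≡ = length-empty _ none
    where
    square : ∀ r → r < 5 → ¬ ((r * r) % 5 ≡ 2 ⊎ (r * r) % 5 ≡ 3)
    square 0 _ (inj₁ ())
    square 0 _ (inj₂ ())
    square 1 _ (inj₁ ())
    square 1 _ (inj₂ ())
    square 2 _ (inj₁ ())
    square 2 _ (inj₂ ())
    square 3 _ (inj₁ ())
    square 3 _ (inj₂ ())
    square 4 _ (inj₁ ())
    square 4 _ (inj₂ ())
    square (suc (suc (suc (suc (suc _))))) (s≤s (s≤s (s≤s (s≤s (s≤s ()))))) _
    none : ∀ {x} → ¬ (x ∈ roots n)
    none {x} i with refl ← ∈-rootsIn⁻ {n} {n} {x} i = square (∣ x ∣ % 5) (ℕ.m%n<n ∣ x ∣ 5)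
      (subst (λ r → r ≡ 2 ⊎ r ≡ 3) (ℕ.%-distribˡ-* ∣ x ∣ ∣ x ∣ 5) n≡)

-- Series modulo 5: the Frobenius map and generating functions

module ThetaSeries where
  open OverpartitionCounts
  open SumsOfSquares
  open import Data.Integer using (+_; -[1+_])
  open ≡ using (refl)

  module F₅ = CommutativeRing ℤ/5
  open PowerSeries ℤ/5
  module K = CommutativeRing ring
  open CommutativeRing ring using (_≈_; _+_; _*_; -_; _-_; 0#; 1#)
  open Exp K.semiring using (_^_; ^-congˡ; ^-homo-*; ^-assocʳ)
  open Exp F₅.semiring using () renaming (_^_ to _R^_; ^-congˡ to ^ʳ-congˡ)

  5≋0 : Char5 ring
  5≋0 = coeffwise λ where
    zero    → mod₅ ≡.refl
    (suc n) → mod₅ ≡.refl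

  module KS = Char5Solver ring 5≋0
  open KS using (_:+_; _:*_; _:-_; :-_; _:^_; _:=_; con)
  module G = GaussIdentity ring 5≋0 (- X)

  m≡₅m%5 : ∀ m → m ≡₅ m % 5
  m≡₅m%5 m = mod₅ (≡.sym (ℕ.m%n%n≡m%n m 5))

  fermat : ∀ a → a R^ 5 ≡₅ a
  fermat a = F₅.trans (^ʳ-congˡ 5 (m≡₅m%5 a)) (F₅.trans (small (a % 5) (ℕ.m%n<n a 5)) (F₅.sym (m≡₅m%5 a)))
    where
    small : ∀ r → r ℕ.< 5 → r R^ 5 ≡₅ r
    small 0 _ = mod₅ ≡.refl
    small 1 _ = mod₅ ≡.refl
    small 2 _ = mod₅ ≡.refl
    small 3 _ = mod₅ ≡.refl
    small 4 _ = mod₅ ≡.refl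
    small (suc (suc (suc (suc (suc _))))) (s≤s (s≤s (s≤s (s≤s (s≤s ())))))

  const-^ : ∀ a n → const (a R^ n) ≈ const a ^ n
  const-^ a zero    = K.refl
  const-^ a (suc n) = K.trans (const-* a (a R^ n)) (K.*-congˡ (const-^ a n))

  -- Fifth powers are additive here, so f = f(0) + q (tail f) gives f⁵ = f(0)⁵ + q⁵ (tail f)⁵. With
  -- `fermat` for the constant term, this is the recursion that defines `V₅`.
  frobenius : ∀ f → f ^ 5 ≈ V₅ f
  frobenius f = coeffwise λ n → go n f
    where
    open SetoidReasoning K.setoid
    split : ∀ f → f ^ 5 ≈ const (f 0 R^ 5) + shift 5 (tail f ^ 5)
    split f = begin
      f ^ 5                           ≈⟨ ^-congˡ 5 (decompose f) ⟩
      (const (f 0) + X * tail f) ^ 5  ≈⟨ KS.solve 3 (λ a x g → (a :+ x :* g) :^ 5 := a :^ 5 :+ x :^ 5 :* g :^ 5)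
                                                        K.refl (const (f 0)) X (tail f) ⟩
      const (f 0) ^ 5 + X ^ 5 * tail f ^ 5     ≈⟨ K.+-cong (K.sym (const-^ (f 0) 5)) (X^-⊛ 5 (tail f ^ 5)) ⟩
      const (f 0 R^ 5) + shift 5 (tail f ^ 5)  ∎
    go : ∀ n f → (f ^ 5) n ≡₅ V₅ f n
    go 0 f = F₅.trans (coeff (split f) 0) (F₅.trans (F₅.+-identityʳ _) (fermat (f 0)))
    go 1 f = coeff (split f) 1
    go 2 f = coeff (split f) 2
    go 3 f = coeff (split f) 3
    go 4 f = coeff (split f) 4
    go (suc (suc (suc (suc (suc n))))) f = F₅.trans (coeff (split f) (5 ℕ.+ n)) (go n (tail f))

  shift-< : ∀ {k n} f → n < k → shift k f n ≡ 0
  shift-< {suc k} {zero}  f _         = refl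
  shift-< {suc k} {suc n} f (s≤s n<k) = shift-< f n<k

  shift-+ : ∀ k f n → shift k f (k ℕ.+ n) ≡ f n
  shift-+ zero    f n = refl
  shift-+ (suc k) f n = shift-+ k f n

  X^≋shift : ∀ k → X ^ k ≈ shift k 1#
  X^≋shift k = K.trans (K.sym (K.*-identityʳ _)) (X^-⊛ k 1#)

  shift-≢ : ∀ k n → k ≢ n → shift k 1# n ≡ 0
  shift-≢ zero    zero    k≢n = ⊥-elim (k≢n refl)
  shift-≢ zero    (suc n) k≢n = refl
  shift-≢ (suc k) zero    k≢n = refl
  shift-≢ (suc k) (suc n) k≢n = shift-≢ k n (λ eq → k≢n (≡.cong suc eq))

  shift-≡ : ∀ k → shift k 1# k ≡ 1
  shift-≡ zero    = refl
  shift-≡ (suc k) = shift-≡ k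

  module _ {A : Set} where
    -- Σ_{a ∈ as} q^{w a}
    genfun : List A → (A → ℕ) → Series
    genfun as w n = length (filter (λ a → w a ℕ.≟ n) as)

    genfun-∷ : ∀ a as w → genfun (a ∷ as) w ≈ X ^ w a + genfun as w
    genfun-∷ a as w = K.trans (coeffwise go) (K.+-congʳ (K.sym (X^≋shift (w a))))
      where
      go : ∀ n → genfun (a ∷ as) w n ≡₅ (shift (w a) 1# + genfun as w) n
      go n with w a ℕ.≟ n
      ... | yes refl = ≡⇒≡₅ (≡.trans (≡.cong length (filter-accept (λ b → w b ℕ.≟ n) {x = a} {xs = as} refl))
                         (≡.cong (ℕ._+ genfun as w n) (≡.sym (shift-≡ (w a)))))
      ... | no  wa≢n = ≡⇒≡₅ (≡.trans (≡.cong length (filter-reject (λ b → w b ℕ.≟ n) {x = a} {xs = as} wa≢n))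
                         (≡.cong (ℕ._+ genfun as w n) (≡.sym (shift-≢ (w a) n wa≢n))))

    genfun-++ : ∀ as bs w → genfun (as ++ bs) w ≈ genfun as w + genfun bs w
    genfun-++ as bs w = coeffwise λ n → ≡⇒≡₅
      (≡.trans (≡.cong length (filter-++ (λ a → w a ℕ.≟ n) as bs)) (length-++ (filter (λ a → w a ℕ.≟ n) as)))

  _⊞_ : ∀ {A B : Set} → (A → ℕ) → (B → ℕ) → A × B → ℕ
  (u ⊞ v) (a , b) = u a ℕ.+ v b

  X^-genfun : ∀ {A B : Set} (a : A) bs (u : A → ℕ) (v : B → ℕ) →
              X ^ u a * genfun bs v ≈ genfun (map (a ,_) bs) (u ⊞ v)
  X^-genfun a []       u v = K.zeroʳ _
  X^-genfun a (b ∷ bs) u v = begin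
    X ^ u a * genfun (b ∷ bs) v                         ≈⟨ K.*-congˡ (genfun-∷ b bs v) ⟩
    X ^ u a * (X ^ v b + genfun bs v)                   ≈⟨ K.distribˡ (X ^ u a) _ _ ⟩
    X ^ u a * X ^ v b + X ^ u a * genfun bs v           ≈⟨ K.+-cong (K.sym (^-homo-* X (u a) (v b))) (X^-genfun a bs u v) ⟩
    X ^ (u a ℕ.+ v b) + genfun (map (a ,_) bs) (u ⊞ v)  ≈⟨ genfun-∷ (a , b) (map (a ,_) bs) (u ⊞ v) ⟨
    genfun (map (a ,_) (b ∷ bs)) (u ⊞ v)                ∎
    where
    open SetoidReasoning K.setoid

  genfun-* : ∀ {A B : Set} as bs (u : A → ℕ) (v : B → ℕ) →
             genfun as u * genfun bs v ≈ genfun (cartesianProduct as bs) (u ⊞ v)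
  genfun-* []       bs u v = K.zeroˡ _
  genfun-* (a ∷ as) bs u v = begin
    genfun (a ∷ as) u * genfun bs v                    ≈⟨ K.*-congʳ (genfun-∷ a as u) ⟩
    (X ^ u a + genfun as u) * genfun bs v              ≈⟨ K.distribʳ (genfun bs v) _ _ ⟩
    X ^ u a * genfun bs v + genfun as u * genfun bs v  ≈⟨ K.+-cong (X^-genfun a bs u v) (genfun-* as bs u v) ⟩
    genfun (map (a ,_) bs) (u ⊞ v) + genfun (cartesianProduct as bs) (u ⊞ v) ≈⟨ genfun-++ (map (a ,_) bs) (cartesianProduct as bs) (u ⊞ v) ⟨
    genfun (cartesianProduct (a ∷ as) bs) (u ⊞ v)                        ∎
    where
    open SetoidReasoning K.setoid

  -- The theta series and its components modulo 5

  φ : Series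
  φ n = length (roots n)

  opaque
    unfolding rootsIn pointsIn

    genfun-box : ∀ {N n} → n ≤ N → genfun (box N) sq n ≡ φ n
    genfun-box n≤N = rootsIn-length n≤N

    -- Up to degree n, `φ` agrees with the generating function of the finite list `box n`, and a
    -- product of such functions enumerates pairs.
    φ²-points : ∀ n → (φ * φ) n ≡₅ length (points n)
    φ²-points n = F₅.trans (⊛-cong-≤ n truncate truncate) (coeff (genfun-* (box n) (box n) sq sq) n)
      where
      truncate : ∀ i → i ≤ n → φ i ≡₅ genfun (box n) sq i
      truncate i i≤n = ≡⇒≡₅ (≡.sym (genfun-box i≤n))

  multiple-of-5 : ∀ n → n % 5 ≡ 0 → ∃ λ m → n ≡ m ℕ.* 5
  multiple-of-5 n eq = n / 5 , ≡.trans (ℕ.m≡m%n+[m/n]*n n 5) (≡.cong (ℕ._+ n / 5 ℕ.* 5) eq)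

  -- The points counted twice in `points-×5` are the multiples of 5. They occur in norm 5n only if n
  -- = 5m, one for each point of norm m, and so contribute `V₅ (φ * φ)`.
  U₅-φ² : U₅ (φ * φ) + V₅ (φ * φ) ≈ φ * φ + φ * φ
  U₅-φ² = coeffwise λ n → begin
    (φ * φ) (n ℕ.* 5) ℕ.+ V₅ (φ * φ) n
      ≈⟨ F₅.+-cong (φ²-points (n ℕ.* 5)) (F₅.sym (both n)) ⟩
    length (points (n ℕ.* 5)) ℕ.+ length (filter doubly? (points (n ℕ.* 5)))
      ≡⟨ points-×5 n ⟩
    length (points n) ℕ.+ length (points n)
      ≈⟨ F₅.+-cong (φ²-points n) (φ²-points n) ⟨
    (φ * φ) n ℕ.+ (φ * φ) n ∎
    where
    open SetoidReasoning F₅.setoid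
    both : ∀ n → length (filter doubly? (points (n ℕ.* 5))) ≡₅ V₅ (φ * φ) n
    both n with n % 5 ℕ.≟ 0
    ... | no n≢0 = F₅.trans (≡⇒≡₅ (doubly-≢0 n n≢0)) (F₅.sym (supp-V₅ (φ * φ) n n≢0))
    ... | yes n≡0 with m , refl ← multiple-of-5 n n≡0 = F₅.trans (≡⇒≡₅ (doubly-×5 m))
      (F₅.trans (F₅.sym (φ²-points m)) (F₅.sym (coeff (U₅V₅ (φ * φ)) m)))

  U₅-φ : U₅ φ ≈ V₅ φ
  U₅-φ = coeffwise go
    where
    go : ∀ n → φ (n ℕ.* 5) ≡₅ V₅ φ n
    go n with n % 5 ℕ.≟ 0
    ... | no n≢0 = F₅.trans (≡⇒≡₅ (roots-×5-≢0 n n≢0)) (F₅.sym (supp-V₅ φ n n≢0))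
    ... | yes n≡0 with m , refl ← multiple-of-5 n n≡0 =
      F₅.trans (≡⇒≡₅ (roots-×25 m)) (F₅.sym (coeff (U₅V₅ φ) m))

  restrict : ℕ → Series → Series
  restrict r f n with n % 5 ℕ.≟ r % 5
  ... | yes _ = f n
  ... | no  _ = 0

  supp-restrict : ∀ r f → SupportedOn r (restrict r f)
  supp-restrict r f n n≢r with n % 5 ℕ.≟ r % 5
  ... | yes n≡r = ⊥-elim (n≢r n≡r)
  ... | no  _   = F₅.refl

  restrict-≡ : ∀ r f n → n % 5 ≡ r % 5 → restrict r f n ≡ f n
  restrict-≡ r f n n≡r with n % 5 ℕ.≟ r % 5
  ... | yes _   = refl
  ... | no  n≢r = ⊥-elim (n≢r n≡r)

  ψ φ₀ φ₁ φ₄ : Series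
  ψ = V₅ φ
  φ₀ = V₅ ψ
  φ₁ = restrict 1 φ
  φ₄ = restrict 4 φ

  dissection : φ ≈ φ₀ + φ₁ + φ₄
  dissection = coeffwise λ n → F₅.sym (go n (n % 5) refl (ℕ.m%n<n n 5))
    where
    ≢-via : ∀ {n r s} → n ≡ r → r ≢ s → n ≢ s
    ≢-via refl r≢s = r≢s
    value : ∀ n {x y z u} → φ₀ n ≡₅ x → φ₁ n ≡₅ y → φ₄ n ≡₅ z → (x ℕ.+ y) ℕ.+ z ≡ u → u ≡₅ φ n → (φ₀ + φ₁ + φ₄) n ≡₅ φ n
    value n p q s eq t = F₅.trans (F₅.+-cong (F₅.+-cong p q) s) (F₅.trans (≡⇒≡₅ eq) t)
    go : ∀ n r → n % 5 ≡ r → r < 5 → (φ₀ + φ₁ + φ₄) n ≡₅ φ n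
    go n 0 eq _ with m , refl ← multiple-of-5 n eq = value n
      (coeff (U₅V₅ ψ) m) (supp-restrict 1 φ n (≢-via eq λ ())) (supp-restrict 4 φ n (≢-via eq λ ()))
      (≡.trans (ℕ.+-identityʳ _) (ℕ.+-identityʳ _)) (F₅.sym (coeff U₅-φ m))
    go n 1 eq _ = value n
      (supp-V₅ ψ n (≢-via eq λ ())) (≡⇒≡₅ (restrict-≡ 1 φ n eq)) (supp-restrict 4 φ n (≢-via eq λ ()))
      (ℕ.+-identityʳ _) F₅.refl
    go n 4 eq _ = value n
      (supp-V₅ ψ n (≢-via eq λ ())) (supp-restrict 1 φ n (≢-via eq λ ())) (≡⇒≡₅ (restrict-≡ 4 φ n eq))
      refl F₅.refl
    go n 2 eq _ = value n
      (supp-V₅ ψ n (≢-via eq λ ())) (supp-restrict 1 φ n (≢-via eq λ ())) (supp-restrict 4 φ n (≢-via eq λ ()))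
      refl (≡⇒≡₅ (≡.sym (roots-nonresidue n (inj₁ eq))))
    go n 3 eq _ = value n
      (supp-V₅ ψ n (≢-via eq λ ())) (supp-restrict 1 φ n (≢-via eq λ ())) (supp-restrict 4 φ n (≢-via eq λ ()))
      refl (≡⇒≡₅ (≡.sym (roots-nonresidue n (inj₂ eq))))
    go n (suc (suc (suc (suc (suc _))))) _ (s≤s (s≤s (s≤s (s≤s (s≤s ())))))

  open SetoidReasoning K.setoid

  -- The overpartition series as the inverse of the theta series

  boundedSeries followsSeries : ℕ → Series
  boundedSeries m n = length (bounded m n)
  followsSeries m n = length (follows m n)

  module _ (m : ℕ) where
    private
      s = suc m
      b  = alternate (boundedSeries m)
      b′ = alternate (boundedSeries s)
      f  = alternate (followsSeries s)
      y  = (- X) ^ s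

    followsSeries-suc : followsSeries s ≈ boundedSeries m + shift s (followsSeries s)
    followsSeries-suc = coeffwise λ n → ≡⇒≡₅ (go n)
      where
      go : ∀ n → followsSeries s n ≡ boundedSeries m n ℕ.+ shift s (followsSeries s) n
      go n with n ℕ.<? s
      ... | yes n<s = ≡.trans (follows-< {m} n<s) (≡.trans (≡.sym (ℕ.+-identityʳ _))
                        (≡.cong (boundedSeries m n ℕ.+_) (≡.sym (shift-< (followsSeries s) n<s))))
      ... | no  n≮s with k , refl ← ℕ.m≤n⇒∃[o]m+o≡n (ℕ.≮⇒≥ n≮s) = ≡.trans (follows-+ {m} k)
                        (≡.cong (boundedSeries m (s ℕ.+ k) ℕ.+_) (≡.sym (shift-+ s (followsSeries s) k)))

    boundedSeries-suc : boundedSeries s ≈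
                        boundedSeries m + (shift s (followsSeries s) + shift s (followsSeries s))
    boundedSeries-suc = coeffwise λ n → ≡⇒≡₅ (go n)
      where
      go : ∀ n → boundedSeries s n ≡
                 boundedSeries m n ℕ.+ (shift s (followsSeries s) n ℕ.+ shift s (followsSeries s) n)
      go n with n ℕ.<? s
      ... | yes n<s = ≡.trans (bounded-< {m} n<s) (≡.trans (≡.sym (ℕ.+-identityʳ _))
                        (≡.cong (λ z → boundedSeries m n ℕ.+ (z ℕ.+ z)) (≡.sym (shift-< (followsSeries s) n<s))))
      ... | no  n≮s with k , refl ← ℕ.m≤n⇒∃[o]m+o≡n (ℕ.≮⇒≥ n≮s) = ≡.trans (bounded-+ {m} k)
                        (≡.cong (λ z → boundedSeries m (s ℕ.+ k) ℕ.+ (z ℕ.+ z)) (≡.sym (shift-+ s (followsSeries s) k)))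

    -- Eliminating `f` from f = b + yf and b′ = b + 2yf leaves the factor (1 + y)/(1 - y)
    -- contributed by the parts of size `s`.
    alternate-bounded-suc : (1# - y) * b′ ≈ (1# + y) * b
    alternate-bounded-suc = begin
      (1# - y) * b′
        ≈⟨ K.*-congˡ b′≈ ⟩
      (1# - y) * (b + (y * f + y * f))
        ≈⟨ KS.solve 3 (λ b f y → (con 1 :- y) :* (b :+ (y :* f :+ y :* f)) :=
             (con 1 :- y) :* b :+ (y :+ y) :* (f :- y :* f)) K.refl b f y ⟩
      (1# - y) * b + (y + y) * (f - y * f)
        ≈⟨ K.+-congˡ (K.*-congˡ (K.+-congʳ f≈)) ⟩
      (1# - y) * b + (y + y) * (b + y * f - y * f)
        ≈⟨ KS.solve 3 (λ b f y → (con 1 :- y) :* b :+ (y :+ y) :* (b :+ y :* f :- y :* f) := (con 1 :+ y) :* b) K.refl b f y ⟩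
      (1# + y) * b ∎
      where
      f≈ : f ≈ b + y * f
      f≈ = K.trans (alternate-cong followsSeries-suc) (K.trans (alternate-+ _ _) (K.+-congˡ (alternate-shift s (followsSeries s))))
      b′≈ : b′ ≈ b + (y * f + y * f)
      b′≈ = K.trans (alternate-cong boundedSeries-suc) (K.trans (alternate-+ _ _) (K.+-congˡ
        (K.trans (alternate-+ _ _) (K.+-cong (alternate-shift s (followsSeries s)) (alternate-shift s (followsSeries s))))))

  bounded-product : ∀ m → G.⟨x⟩ m * alternate (boundedSeries m) ≈ G.⟨-x⟩ m
  bounded-product zero = coeffwise λ n → F₅.trans (coeff (K.*-identityˡ _) n) (go n)
    where
    go : ∀ n → alternate (boundedSeries 0) n ≡₅ 1# n
    go zero    = F₅.refl
    go (suc n) = F₅.trans (F₅.*-congˡ {sgn (suc n)} (≡⇒≡₅ (bounded-zero n))) (F₅.zeroʳ (sgn (suc n)))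
  bounded-product (suc m) = begin
    (1# - y) * e * b′    ≈⟨ KS.solve 3 (λ u e b → u :* e :* b := e :* (u :* b)) K.refl (1# - y) e b′ ⟩
    e * ((1# - y) * b′)  ≈⟨ K.*-congˡ (alternate-bounded-suc m) ⟩
    e * ((1# + y) * b)   ≈⟨ KS.solve 3 (λ u e b → e :* (u :* b) := u :* (e :* b)) K.refl (1# + y) e b ⟩
    (1# + y) * (e * b)   ≈⟨ K.*-congˡ (bounded-product m) ⟩
    (1# + y) * G.⟨-x⟩ m  ∎
    where
    y = (- X) ^ suc m
    e = G.⟨x⟩ m
    b = alternate (boundedSeries m)
    b′ = alternate (boundedSeries (suc m))

  -- (−1)^{m²} = (−1)^m, so that substituting x = −q removes all signs from Σ (−1)^j x^{j²}.
  neg-power : ∀ m y → (- (- y) ^ m) ^ m ≈ y ^ (m ℕ.* m)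
  neg-power m y = K.trans (square (parity m)) (^-assocʳ y m m)
    where
    parity : ∀ k → (∀ z → (- z) ^ k ≈ z ^ k) ⊎ (∀ z → (- z) ^ k ≈ - z ^ k)
    parity zero = inj₁ λ z → K.refl
    parity (suc k) with parity k
    ... | inj₁ even = inj₂ λ z → K.trans (K.*-congˡ (even z))
            (KS.solve 2 (λ z w → (:- z) :* w := :- (z :* w)) K.refl z (z ^ k))
    ... | inj₂ odd  = inj₁ λ z → K.trans (K.*-congˡ (odd z))
            (KS.solve 2 (λ z w → (:- z) :* (:- w) := z :* w) K.refl z (z ^ k))
    square : (∀ z → (- z) ^ m ≈ z ^ m) ⊎ (∀ z → (- z) ^ m ≈ - z ^ m) →
             (- (- y) ^ m) ^ m ≈ (y ^ m) ^ m
    square (inj₁ even) = K.trans (even ((- y) ^ m)) (^-congˡ m (even y))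
    square (inj₂ odd)  = ^-congˡ m (K.trans (K.-‿cong (odd y))
      (KS.solve 1 (λ w → :- (:- w) := w) K.refl (y ^ m)))

  theta-box : ∀ N → G.theta N ≈ genfun (box N) sq
  theta-box zero = K.sym (K.trans (genfun-∷ (+ 0) [] sq) (K.+-identityʳ 1#))
  theta-box (suc N) = begin
    G.theta N + (1# + 1#) * (- (- X) ^ suc N) ^ suc N
      ≈⟨ K.+-cong (theta-box N) (K.*-congˡ (neg-power (suc N) X)) ⟩
    g + (1# + 1#) * x²
      ≈⟨ KS.solve 2 (λ g x → g :+ (con 1 :+ con 1) :* x := x :+ (x :+ g)) K.refl g x² ⟩
    x² + (x² + g)
      ≈⟨ K.+-congˡ {x²} (genfun-∷ -[1+ N ] (box N) sq) ⟨
    x² + genfun (-[1+ N ] ∷ box N) sq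
      ≈⟨ genfun-∷ (+ suc N) (-[1+ N ] ∷ box N) sq ⟨
    genfun (box (suc N)) sq ∎
    where
    g = genfun (box N) sq
    x² = X ^ (suc N ℕ.* suc N)

  -- As `alternate` is an involution, the product is the alternate of a series shifted by `k`.
  [-X]^-vanish : ∀ {k i} g → i < k → ((- X) ^ k * g) i ≡₅ 0
  [-X]^-vanish {k} {i} g i<k = F₅.trans
    (coeff (K.trans (K.*-congˡ {(- X) ^ k} involutive) (K.sym (alternate-shift k (alternate g)))) i)
    (F₅.trans (F₅.*-congˡ {sgn i} (≡⇒≡₅ (shift-< (alternate g) i<k))) (F₅.zeroʳ (sgn i)))
    where
    involutive : g ≈ alternate (alternate g)
    involutive = coeffwise λ n → F₅.sym (F₅.trans (F₅.sym (F₅.*-assoc (sgn n) (sgn n) (g n)))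
      (F₅.trans (F₅.*-congʳ (sgn-involutive n)) (F₅.*-identityˡ (g n))))

  ⟨x⟩-0 : ∀ n → G.⟨x⟩ n 0 ≡₅ 1
  ⟨x⟩-0 zero    = F₅.refl
  ⟨x⟩-0 (suc n) = F₅.trans (F₅.*-identityˡ _) (⟨x⟩-0 n)

  Q : Series
  Q = alternate p̄

  -- In degree n, `Q` and `φ` may be replaced by their bounded versions. Multiplied by (x; x)_n, the
  -- difference of their product from 1 becomes the remainder of `gauss`, divisible by q^(n+1); and
  -- (x; x)_n has constant term 1, so it cancels.
  Q-φ : Q * φ ≈ 1#
  Q-φ = coeffwise λ n → F₅.trans
    (⊛-cong-≤ n (λ i i≤n → F₅.*-congˡ {sgn i} (≡⇒≡₅ (p̄≡bounded {n} i≤n)))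
      (λ i i≤n → F₅.trans (≡⇒≡₅ (≡.sym (genfun-box i≤n))) (F₅.sym (coeff (theta-box n) i))))
    (approx n)
    where
    approx : ∀ n → (alternate (boundedSeries n) * G.theta n) n ≡₅ 1# n
    approx n with r , eq ← G.gauss n = conclude
      where
      b = alternate (boundedSeries n)
      θ = G.theta n
      e = G.⟨x⟩ n
      h = b * θ - 1#
      eh≈ : e * h ≈ (- X) ^ suc n * r
      eh≈ = begin
        e * (b * θ - 1#)
          ≈⟨ KS.solve 3 (λ e b t → e :* (b :* t :- con 1) := e :* b :* t :- e) K.refl e b θ ⟩
        e * b * θ - e
          ≈⟨ K.+-congʳ (K.*-congʳ (bounded-product n)) ⟩
        G.⟨-x⟩ n * θ - e
          ≈⟨ K.+-congʳ eq ⟩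
        e + (- X) ^ suc n * r - e
          ≈⟨ KS.solve 2 (λ e z → e :+ z :- e := z) K.refl e ((- X) ^ suc n * r) ⟩
        (- X) ^ suc n * r ∎
      h≈0 : h n ≡₅ 0
      h≈0 = vanish-cancelˡ n {e} {h} (⟨x⟩-0 n)
        (λ i i≤n → F₅.trans (coeff eh≈ i) ([-X]^-vanish r (s≤s i≤n))) n ℕ.≤-refl
      conclude : (b * θ) n ≡₅ 1# n
      conclude = F₅.trans
        (coeff (KS.solve 1 (λ z → z := (z :- con 1) :+ con 1) K.refl (b * θ)) n)
        (F₅.+-congʳ {1# n} h≈0)

  -- The action of `U₅` on powers of the theta series

  supp-φ₀ : SupportedOn 0 φ₀
  supp-φ₀ = supp-V₅ ψ
  supp-φ₁ : SupportedOn 1 φ₁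
  supp-φ₁ = supp-restrict 1 φ
  supp-φ₄ : SupportedOn 4 φ₄
  supp-φ₄ = supp-restrict 4 φ

  -- Reduces an evaluation of `U₅` to a sorting of monomials by residue.
  U₅-extract : ∀ {f z g₁ g₂ g₃ g₄} → f ≈ z + g₁ + g₂ + g₃ + g₄ →
    SupportedOn 1 g₁ → SupportedOn 2 g₂ → SupportedOn 3 g₃ → SupportedOn 4 g₄ → U₅ f ≈ U₅ z
  U₅-extract {f} {z} {g₁} {g₂} {g₃} {g₄} eq s₁ s₂ s₃ s₄ = begin
    U₅ f                                  ≈⟨ U₅-cong eq ⟩
    U₅ z + U₅ g₁ + U₅ g₂ + U₅ g₃ + U₅ g₄  ≈⟨ drop (supp-U₅ 4 (λ ()) s₄) ⟩
    U₅ z + U₅ g₁ + U₅ g₂ + U₅ g₃          ≈⟨ drop (supp-U₅ 3 (λ ()) s₃) ⟩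
    U₅ z + U₅ g₁ + U₅ g₂                  ≈⟨ drop (supp-U₅ 2 (λ ()) s₂) ⟩
    U₅ z + U₅ g₁                          ≈⟨ drop (supp-U₅ 1 (λ ()) s₁) ⟩
    U₅ z                                  ∎
    where
    drop : ∀ {u v} → v ≈ 0# → u + v ≈ u
    drop p = K.trans (K.+-congˡ p) (K.+-identityʳ _)

  V₅-+ : ∀ f g → V₅ (f + g) ≈ V₅ f + V₅ g
  V₅-+ f g = K.trans (V₅-cong (K.sym (K.+-cong (U₅V₅ f) (U₅V₅ g))))
    (V₅U₅ {V₅ f + V₅ g} (supp-+ 0 {V₅ f} {V₅ g} (supp-V₅ f) (supp-V₅ g)))

  supp-neg : ∀ r {f} → SupportedOn r f → SupportedOn r (- f)
  supp-neg r p n n≢ = F₅.*-congˡ {4} (p n n≢)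

  φ² φ³ φ⁴ ψ² : Series
  φ² = φ * φ
  φ³ = φ * φ * φ
  φ⁴ = φ * φ * (φ * φ)
  ψ² = ψ * ψ

  -- The part of `φ²` in q⁵ is φ₀² + 2φ₁φ₄, so `U₅-φ²` says 2w + 2ψ² = 2φ² for the `w` below; 3 is
  -- the inverse of 2 modulo 5.
  U₅-φ₁φ₄ : U₅ (φ₁ * φ₄) + ψ² ≈ φ²
  U₅-φ₁φ₄ = begin
    w + ψ²
      ≈⟨ KS.solve 2 (λ w s → w :+ s := con 3 :* ((s :+ (w :+ w)) :+ s)) K.refl w ψ² ⟩
    3′ * ((ψ² + (w + w)) + ψ²)
      ≈⟨ K.*-congˡ {3′} (K.+-cong (K.sym U₅φ²) (K.sym (V₅-* φ φ))) ⟩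
    3′ * (U₅ φ² + V₅ φ²)
      ≈⟨ K.*-congˡ {3′} U₅-φ² ⟩
    3′ * (φ² + φ²)
      ≈⟨ KS.solve 1 (λ s → con 3 :* (s :+ s) := s) K.refl φ² ⟩
    φ² ∎
    where
    3′ = 1# + 1# + 1#
    w = U₅ (φ₁ * φ₄)
    U₅φ² : U₅ φ² ≈ ψ² + (w + w)
    U₅φ² = K.trans
      (U₅-extract {z = φ₀ * φ₀ + (φ₁ * φ₄ + φ₁ * φ₄)} {φ₀ * φ₁ + φ₀ * φ₁} {φ₁ * φ₁} {φ₄ * φ₄} {φ₀ * φ₄ + φ₀ * φ₄}
        (K.trans (K.*-cong dissection dissection)
          (KS.solve 3 (λ a b c → (a :+ b :+ c) :* (a :+ b :+ c) :=
            a :* a :+ (b :* c :+ b :* c) :+ (a :* b :+ a :* b) :+ b :* b :+ c :* c :+ (a :* c :+ a :* c)) K.refl φ₀ φ₁ φ₄))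
        (supp-+ 1 {φ₀ * φ₁} {φ₀ * φ₁} (supp-* 0 1 supp-φ₀ supp-φ₁) (supp-* 0 1 supp-φ₀ supp-φ₁))
        (supp-* 1 1 supp-φ₁ supp-φ₁)
        (supp-* 4 4 supp-φ₄ supp-φ₄)
        (supp-+ 4 {φ₀ * φ₄} {φ₀ * φ₄} (supp-* 0 4 supp-φ₀ supp-φ₄) (supp-* 0 4 supp-φ₀ supp-φ₄)))
      (K.+-congʳ (K.trans (U₅-V₅⊛ ψ φ₀) (K.*-congˡ {ψ} (U₅V₅ ψ))))

  -- Apply `V₅` to `U₅-φ₁φ₄`: since 1 + 4 = 5, the product `φ₁ * φ₄` is a series in q⁵ and is
  -- recovered unchanged.
  φ₀²+φ₁φ₄ : φ₀ * φ₀ + φ₁ * φ₄ ≈ ψ²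
  φ₀²+φ₁φ₄ = begin
    φ₀ * φ₀ + φ₁ * φ₄          ≈⟨ K.+-comm (φ₀ * φ₀) (φ₁ * φ₄) ⟩
    φ₁ * φ₄ + φ₀ * φ₀          ≈⟨ K.+-cong (V₅U₅ {φ₁ * φ₄} (supp-* 1 4 supp-φ₁ supp-φ₄)) (V₅-* ψ ψ) ⟨
    V₅ (U₅ (φ₁ * φ₄)) + V₅ ψ²  ≈⟨ V₅-+ (U₅ (φ₁ * φ₄)) ψ² ⟨
    V₅ (U₅ (φ₁ * φ₄) + ψ²)     ≈⟨ V₅-cong U₅-φ₁φ₄ ⟩
    V₅ φ²                      ≈⟨ V₅-* φ φ ⟩
    ψ²                         ∎

  -- The monomials of residue 0 are φ₀⁴ + 12φ₀²φ₁φ₄ + 6φ₁²φ₄². As 12 is 2 and 6 is 1 modulo 5, this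
  -- is a perfect square, equal to ψ⁴ = `V₅ φ⁴`.
  U₅-φ⁴ : U₅ φ⁴ ≈ φ⁴
  U₅-φ⁴ = K.trans
    (U₅-extract {z = s * s} {g₁} {g₂} {g₃} {g₄}
      (K.trans (K.*-cong (K.*-cong dissection dissection) (K.*-cong dissection dissection))
        (KS.solve 3 (λ a b c → (a :+ b :+ c) :* (a :+ b :+ c) :* ((a :+ b :+ c) :* (a :+ b :+ c)) :=
           (a :* a :+ b :* c) :* (a :* a :+ b :* c)
           -- In the other residues, too, the multinomial coefficients 4, 6 and 12 are written as
           -- -1, 1 and 2.
           :+ (c :* c :* c :* c :- a :* a :* a :* b :+ (a :* b :* b :* c :+ a :* b :* b :* c))
           :+ (a :* a :* b :* b :- b :* b :* b :* c :- a :* c :* c :* c)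
           :+ (a :* a :* c :* c :- a :* b :* b :* b :- b :* c :* c :* c)
           :+ (b :* b :* b :* b :- a :* a :* a :* c :+ (a :* b :* c :* c :+ a :* b :* c :* c))) K.refl φ₀ φ₁ φ₄))
      s₁ s₂ s₃ s₄)
    (K.trans (U₅-cong (K.*-cong φ₀²+φ₁φ₄ φ₀²+φ₁φ₄)) (K.trans (U₅-cong V₅φ⁴) (U₅V₅ φ⁴)))
    where
    s = φ₀ * φ₀ + φ₁ * φ₄
    V₅φ⁴ : ψ² * ψ² ≈ V₅ φ⁴
    V₅φ⁴ = K.trans (K.*-cong (K.sym (V₅-* φ φ)) (K.sym (V₅-* φ φ))) (K.sym (V₅-* φ² φ²))
    g₁ = φ₄ * φ₄ * φ₄ * φ₄ - φ₀ * φ₀ * φ₀ * φ₁ + (φ₀ * φ₁ * φ₁ * φ₄ + φ₀ * φ₁ * φ₁ * φ₄)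
    g₂ = φ₀ * φ₀ * φ₁ * φ₁ - φ₁ * φ₁ * φ₁ * φ₄ - φ₀ * φ₄ * φ₄ * φ₄
    g₃ = φ₀ * φ₀ * φ₄ * φ₄ - φ₀ * φ₁ * φ₁ * φ₁ - φ₁ * φ₄ * φ₄ * φ₄
    g₄ = φ₁ * φ₁ * φ₁ * φ₁ - φ₀ * φ₀ * φ₀ * φ₄ + (φ₀ * φ₁ * φ₄ * φ₄ + φ₀ * φ₁ * φ₄ * φ₄)
    quartic : ∀ i j k l {f₁ f₂ f₃ f₄} → SupportedOn i f₁ → SupportedOn j f₂ → SupportedOn k f₃ → SupportedOn l f₄ →
              SupportedOn (i ℕ.+ j ℕ.+ k ℕ.+ l) (f₁ * f₂ * f₃ * f₄)
    quartic i j k l p q r s = supp-* (i ℕ.+ j ℕ.+ k) l (supp-* (i ℕ.+ j) k (supp-* i j p q) r) s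
    s₁ : SupportedOn 1 g₁
    s₁ = supp-+ 1 {φ₄ * φ₄ * φ₄ * φ₄ - φ₀ * φ₀ * φ₀ * φ₁} {φ₀ * φ₁ * φ₁ * φ₄ + φ₀ * φ₁ * φ₁ * φ₄}
      (supp-+ 1 {φ₄ * φ₄ * φ₄ * φ₄} { - (φ₀ * φ₀ * φ₀ * φ₁)} (quartic 4 4 4 4 supp-φ₄ supp-φ₄ supp-φ₄ supp-φ₄)
        (supp-neg 1 {φ₀ * φ₀ * φ₀ * φ₁} (quartic 0 0 0 1 supp-φ₀ supp-φ₀ supp-φ₀ supp-φ₁)))
      (supp-+ 1 {φ₀ * φ₁ * φ₁ * φ₄} {φ₀ * φ₁ * φ₁ * φ₄} (quartic 0 1 1 4 supp-φ₀ supp-φ₁ supp-φ₁ supp-φ₄)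
        (quartic 0 1 1 4 supp-φ₀ supp-φ₁ supp-φ₁ supp-φ₄))
    s₂ : SupportedOn 2 g₂
    s₂ = supp-+ 2 {φ₀ * φ₀ * φ₁ * φ₁ - φ₁ * φ₁ * φ₁ * φ₄} { - (φ₀ * φ₄ * φ₄ * φ₄)}
      (supp-+ 2 {φ₀ * φ₀ * φ₁ * φ₁} { - (φ₁ * φ₁ * φ₁ * φ₄)} (quartic 0 0 1 1 supp-φ₀ supp-φ₀ supp-φ₁ supp-φ₁)
        (supp-neg 2 {φ₁ * φ₁ * φ₁ * φ₄} (quartic 1 1 1 4 supp-φ₁ supp-φ₁ supp-φ₁ supp-φ₄)))
      (supp-neg 2 {φ₀ * φ₄ * φ₄ * φ₄} (quartic 0 4 4 4 supp-φ₀ supp-φ₄ supp-φ₄ supp-φ₄))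
    s₃ : SupportedOn 3 g₃
    s₃ = supp-+ 3 {φ₀ * φ₀ * φ₄ * φ₄ - φ₀ * φ₁ * φ₁ * φ₁} { - (φ₁ * φ₄ * φ₄ * φ₄)}
      (supp-+ 3 {φ₀ * φ₀ * φ₄ * φ₄} { - (φ₀ * φ₁ * φ₁ * φ₁)} (quartic 0 0 4 4 supp-φ₀ supp-φ₀ supp-φ₄ supp-φ₄)
        (supp-neg 3 {φ₀ * φ₁ * φ₁ * φ₁} (quartic 0 1 1 1 supp-φ₀ supp-φ₁ supp-φ₁ supp-φ₁)))
      (supp-neg 3 {φ₁ * φ₄ * φ₄ * φ₄} (quartic 1 4 4 4 supp-φ₁ supp-φ₄ supp-φ₄ supp-φ₄))
    s₄ : SupportedOn 4 g₄
    s₄ = supp-+ 4 {φ₁ * φ₁ * φ₁ * φ₁ - φ₀ * φ₀ * φ₀ * φ₄} {φ₀ * φ₁ * φ₄ * φ₄ + φ₀ * φ₁ * φ₄ * φ₄}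
      (supp-+ 4 {φ₁ * φ₁ * φ₁ * φ₁} { - (φ₀ * φ₀ * φ₀ * φ₄)} (quartic 1 1 1 1 supp-φ₁ supp-φ₁ supp-φ₁ supp-φ₁)
        (supp-neg 4 {φ₀ * φ₀ * φ₀ * φ₄} (quartic 0 0 0 4 supp-φ₀ supp-φ₀ supp-φ₀ supp-φ₄)))
      (supp-+ 4 {φ₀ * φ₁ * φ₄ * φ₄} {φ₀ * φ₁ * φ₄ * φ₄} (quartic 0 1 4 4 supp-φ₀ supp-φ₁ supp-φ₄ supp-φ₄)
        (quartic 0 1 4 4 supp-φ₀ supp-φ₁ supp-φ₄ supp-φ₄))

  U₅-Q : U₅ Q ≈ φ³
  U₅-Q = begin
    U₅ Q                ≈⟨ K.*-identityʳ (U₅ Q) ⟨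
    -- Inserting `Q * φ` replaces a cancellation of `φ`: the factor `φ` enters `U₅` as `V₅ φ`, and
    -- the spare `Q` divides it out again at the end.
    U₅ Q * 1#           ≈⟨ K.*-congˡ {U₅ Q} Q-φ ⟨
    U₅ Q * (Q * φ)      ≈⟨ KS.solve 3 (λ u q f → u :* (q :* f) := u :* f :* q) K.refl (U₅ Q) Q φ ⟩
    U₅ Q * φ * Q        ≈⟨ K.*-congʳ {Q} (U₅-⊛V₅ Q φ) ⟨
    U₅ (Q * V₅ φ) * Q   ≈⟨ K.*-congʳ {Q} (U₅-cong (K.*-congˡ {Q} (frobenius φ))) ⟨
    U₅ (Q * φ ^ 5) * Q  ≈⟨ K.*-congʳ {Q} (U₅-cong Qφ⁵) ⟩
    U₅ φ⁴ * Q           ≈⟨ K.*-congʳ {Q} U₅-φ⁴ ⟩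
    φ⁴ * Q              ≈⟨ KS.solve 2 (λ q f → f :* f :* (f :* f) :* q := f :* f :* f :* (q :* f)) K.refl Q φ ⟩
    φ³ * (Q * φ)        ≈⟨ K.*-congˡ {φ³} Q-φ ⟩
    φ³ * 1#             ≈⟨ K.*-identityʳ φ³ ⟩
    φ³                  ∎
    where
    Qφ⁵ : Q * φ ^ 5 ≈ φ⁴
    Qφ⁵ = K.trans (KS.solve 2 (λ q f → q :* f :^ 5 := (q :* f) :* (f :* f :* (f :* f))) K.refl Q φ)
      (K.trans (K.*-congʳ {φ⁴} Q-φ) (K.*-identityˡ φ⁴))

  -- The parts of `φ³` in the residues 2 and 3; later only their supports matter.
  cubic₂ cubic₃ : Series
  cubic₂ = φ₄ * φ₄ * φ₄ + (φ₀ * φ₁ * φ₁ + φ₀ * φ₁ * φ₁ + φ₀ * φ₁ * φ₁)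
  cubic₃ = φ₁ * φ₁ * φ₁ + (φ₀ * φ₄ * φ₄ + φ₀ * φ₄ * φ₄ + φ₀ * φ₄ * φ₄)

  -- Exchanging `φ₁` and `φ₄` exchanges the two cubics, so one argument with residues satisfying 2r
  -- = 3s modulo 5 covers both.
  supp-cubic : ∀ r s {f g} → SupportedOn 0 φ₀ → SupportedOn r f → SupportedOn s g → (r ℕ.+ r) % 5 ≡ (s ℕ.+ s ℕ.+ s) % 5 →
               SupportedOn (r ℕ.+ r) (g * g * g + (φ₀ * f * f + φ₀ * f * f + φ₀ * f * f))
  supp-cubic r s {f} {g} sA sf sg eq = supp-+ (r ℕ.+ r) {g * g * g} {aff + aff + aff}
    (λ n n≢ → supp-* (s ℕ.+ s) s (supp-* s s sg sg) sg n (λ e → n≢ (≡.trans e (≡.sym eq))))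
    (supp-+ (r ℕ.+ r) {aff + aff} {aff} (supp-+ (r ℕ.+ r) {aff} {aff} saff saff) saff)
    where
    aff = φ₀ * f * f
    saff : SupportedOn (r ℕ.+ r) aff
    saff = supp-* r r (supp-* 0 r sA sf) sf

  supp-cubic₂ : SupportedOn 2 cubic₂
  supp-cubic₂ = supp-cubic 1 4 supp-φ₀ supp-φ₁ supp-φ₄ refl

  supp-cubic₃ : SupportedOn 3 cubic₃
  supp-cubic₃ = supp-cubic 4 1 supp-φ₀ supp-φ₄ supp-φ₁ refl

  -- In the residues 0, 1 and 4 the monomials group into multiples of φ₀² + φ₁φ₄. Residue 0 needs
  -- characteristic 5, to turn 6φ₀φ₁φ₄ into φ₀φ₁φ₄.
  φ³-dissection : φ³ ≈ φ₀ * ψ² + (φ₁ * ψ² + φ₁ * ψ² + φ₁ * ψ²) + cubic₂ + cubic₃ + (φ₄ * ψ² + φ₄ * ψ² + φ₄ * ψ²)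
  φ³-dissection = begin
    φ³
      ≈⟨ K.*-cong (K.*-cong dissection dissection) dissection ⟩
    d * d * d
      ≈⟨ KS.solve 3 (λ a b c → (a :+ b :+ c) :* (a :+ b :+ c) :* (a :+ b :+ c) :=
           a :* (a :* a :+ b :* c)
           :+ (b :* (a :* a :+ b :* c) :+ b :* (a :* a :+ b :* c) :+ b :* (a :* a :+ b :* c))
           :+ (c :* c :* c :+ (a :* b :* b :+ a :* b :* b :+ a :* b :* b))
           :+ (b :* b :* b :+ (a :* c :* c :+ a :* c :* c :+ a :* c :* c))
           :+ (c :* (a :* a :+ b :* c) :+ c :* (a :* a :+ b :* c) :+ c :* (a :* a :+ b :* c))) K.refl φ₀ φ₁ φ₄ ⟩
    φ₀ * s + (φ₁ * s + φ₁ * s + φ₁ * s) + cubic₂ + cubic₃ + (φ₄ * s + φ₄ * s + φ₄ * s)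
      ≈⟨ K.+-cong (K.+-congʳ (K.+-congʳ (K.+-cong (times φ₀) (K.+-cong (K.+-cong (times φ₁) (times φ₁)) (times φ₁)))))
           (K.+-cong (K.+-cong (times φ₄) (times φ₄)) (times φ₄)) ⟩
    φ₀ * ψ² + (φ₁ * ψ² + φ₁ * ψ² + φ₁ * ψ²) + cubic₂ + cubic₃ + (φ₄ * ψ² + φ₄ * ψ² + φ₄ * ψ²) ∎
    where
    d = φ₀ + φ₁ + φ₄
    s = φ₀ * φ₀ + φ₁ * φ₄
    times : ∀ f → f * s ≈ f * ψ²
    times f = K.*-congˡ {f} φ₀²+φ₁φ₄

  supp-a² : SupportedOn 0 ψ²
  supp-a² = supp-* 0 0 (supp-V₅ φ) (supp-V₅ φ)

  -- `φ₀ * ψ²` is the part in q⁵ both of `φ³` and of `H`, so this value serves for both.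
  U₅-φ₀ψ² : U₅ (φ₀ * ψ²) ≈ ψ * φ²
  U₅-φ₀ψ² = K.trans (U₅-V₅⊛ ψ ψ²) (K.*-congˡ {ψ} (K.trans (U₅-V₅⊛ φ ψ) (K.*-congˡ {φ} (U₅V₅ φ))))

  U₅-φ³ : U₅ φ³ ≈ ψ * φ²
  U₅-φ³ = K.trans
    (U₅-extract {z = φ₀ * ψ²} {φ₁ * ψ² + φ₁ * ψ² + φ₁ * ψ²} {cubic₂} {cubic₃} {φ₄ * ψ² + φ₄ * ψ² + φ₄ * ψ²}
      φ³-dissection (triple 1 supp-φ₁) supp-cubic₂ supp-cubic₃ (triple 4 supp-φ₄))
    U₅-φ₀ψ²
    where
    triple : ∀ r {f} → SupportedOn r f → SupportedOn r (f * ψ² + f * ψ² + f * ψ²)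
    triple r {f} sf = supp-+ r {f * ψ² + f * ψ²} {f * ψ²} (supp-+ r {f * ψ²} {f * ψ²} sfa sfa) sfa
      where
      sfa : SupportedOn r (f * ψ²)
      sfa n n≢ = supp-* r 0 {f} {ψ²} sf supp-a² n (λ e → n≢ (≡.trans e (≡.cong (_% 5) (ℕ.+-identityʳ r))))

  -- This is `φ` times 2φ² - ψ², the value of `U₅ φ²`; it arises when `V₅ φ` is pulled out of
  -- `U₅ (ψ * φ²)`.
  H : Series
  H = φ³ + φ³ - φ * ψ²

  U₅-ψφ² : U₅ (ψ * φ²) ≈ H
  U₅-ψφ² = begin
    U₅ (V₅ φ * φ²)                   ≈⟨ U₅-V₅⊛ φ φ² ⟩
    φ * U₅ φ²                        ≈⟨ KS.solve 3 (λ f u v → f :* u := f :* (u :+ v) :- f :* v) K.refl φ (U₅ φ²) (V₅ φ²) ⟩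
    φ * (U₅ φ² + V₅ φ²) - φ * V₅ φ²  ≈⟨ K.+-cong (K.*-congˡ {φ} U₅-φ²) (K.-‿cong (K.*-congˡ {φ} (V₅-* φ φ))) ⟩
    φ * (φ² + φ²) - φ * ψ²           ≈⟨ KS.solve 2 (λ f v → f :* (f :* f :+ f :* f) :- f :* v :=
                                                f :* f :* f :+ f :* f :* f :- f :* v) K.refl φ ψ² ⟩
    H ∎

  -- The components of 2φ³ on the residues ±1 are 6φ₁ψ² and 6φ₄ψ², and those of φψ² are φ₁ψ² and φ₄ψ².
  H-dissection : H ≈ φ₀ * ψ² + (cubic₂ + cubic₂) + (cubic₃ + cubic₃)
  H-dissection = K.trans
    (K.+-cong (K.+-cong φ³-dissection φ³-dissection) (K.-‿cong (K.*-congʳ {ψ²} dissection)))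
    (KS.solve 6 (λ a b c v p q →
      (a :* v :+ (b :* v :+ b :* v :+ b :* v) :+ p :+ q :+ (c :* v :+ c :* v :+ c :* v))
      :+ (a :* v :+ (b :* v :+ b :* v :+ b :* v) :+ p :+ q :+ (c :* v :+ c :* v :+ c :* v))
      :- (a :+ b :+ c) :* v := a :* v :+ (p :+ p) :+ (q :+ q)) K.refl φ₀ φ₁ φ₄ ψ² cubic₂ cubic₃)

  supp-H₂ : SupportedOn 2 (cubic₂ + cubic₂)
  supp-H₂ = supp-+ 2 {cubic₂} {cubic₂} supp-cubic₂ supp-cubic₂

  supp-H₃ : SupportedOn 3 (cubic₃ + cubic₃)
  supp-H₃ = supp-+ 3 {cubic₃} {cubic₃} supp-cubic₃ supp-cubic₃

  U₅-H : U₅ H ≈ ψ * φ²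
  U₅-H = K.trans
    (U₅-extract {z = φ₀ * ψ²} {0#} {cubic₂ + cubic₂} {cubic₃ + cubic₃} {0#}
      (K.trans H-dissection (K.trans (K.+-congʳ (K.+-congʳ (K.sym (K.+-identityʳ (φ₀ * ψ²))))) (K.sym (K.+-identityʳ _))))
      (λ _ _ → F₅.refl) supp-H₂ supp-H₃ (λ _ _ → F₅.refl))
    U₅-φ₀ψ²

  H-vanish : ∀ n → n % 5 ≢ 0 → n % 5 ≢ 2 → n % 5 ≢ 3 → H n ≡₅ 0
  H-vanish n n≢0 n≢2 n≢3 = F₅.trans (coeff H-dissection n)
    (F₅.+-cong (F₅.+-cong (supp-* 0 0 supp-φ₀ supp-a² n n≢0) (supp-H₂ n n≢2)) (supp-H₃ n n≢3))

  -- Iterates of `U₅` on the overpartition series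

  U₅^ : ℕ → Series → Series
  U₅^ zero    f = f
  U₅^ (suc k) f = U₅^ k (U₅ f)

  U₅^-cong : ∀ k {f g} → f ≈ g → U₅^ k f ≈ U₅^ k g
  U₅^-cong zero    p = p
  U₅^-cong (suc k) p = U₅^-cong k (U₅-cong p)

  U₅^-coeff : ∀ k f n → U₅^ k f n ≡ f (5 ℕ.^ k ℕ.* n)
  U₅^-coeff zero    f n = ≡.cong f (≡.sym (ℕ.*-identityˡ n))
  U₅^-coeff (suc k) f n = ≡.trans (U₅^-coeff k (U₅ f) n) (≡.cong f
    (≡.trans (ℕ.*-comm (5 ℕ.^ k ℕ.* n) 5) (≡.sym (ℕ.*-assoc 5 (5 ℕ.^ k) n))))

  U₅^-H : ∀ j → U₅^ (j ℕ.* 2) H ≈ H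
  U₅^-H zero    = K.refl
  U₅^-H (suc j) = K.trans (U₅^-cong (j ℕ.* 2) (K.trans (U₅-cong U₅-H) U₅-ψφ²)) (U₅^-H j)

  -- Three steps lead through `φ³` and `ψ * φ²` to `H`, and `H` recurs every two steps. The exponent
  -- 3 + 2j is 2α + 1 for α = j + 1.
  U₅^-Q : ∀ j → U₅^ (3 ℕ.+ j ℕ.* 2) Q ≈ H
  U₅^-Q j = K.trans
    (U₅^-cong (j ℕ.* 2) (K.trans (U₅-cong (K.trans (U₅-cong U₅-Q) U₅-φ³)) U₅-ψφ²)) (U₅^-H j)

  Q≡0⇒5∣p̄ : ∀ n → Q n ≡₅ 0 → 5 ℕ.∣ p̄ n
  Q≡0⇒5∣p̄ n eq = ℕ.m%n≡0⇒n∣m (p̄ n) 5 (_≡₅_.residues (F₅.trans (F₅.sym (F₅.*-identityˡ (p̄ n)))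
    (F₅.trans (F₅.*-congʳ {p̄ n} (F₅.sym (sgn-involutive n)))
      (F₅.trans (F₅.*-assoc (sgn n) (sgn n) (p̄ n)) (F₅.trans (F₅.*-congˡ {sgn n} eq) (F₅.zeroʳ (sgn n)))))))

  5∣p̄-odd-power : ∀ j n r → r % 5 ≢ 0 → r % 5 ≢ 2 → r % 5 ≢ 3 →
                  5 ℕ.∣ p̄ (5 ℕ.^ (2 ℕ.* suc j ℕ.+ 1) ℕ.* (5 ℕ.* n ℕ.+ r))
  5∣p̄-odd-power j n r r≢0 r≢2 r≢3 = ≡.subst (λ k → 5 ℕ.∣ p̄ (5 ℕ.^ k ℕ.* N)) exponent
    (Q≡0⇒5∣p̄ (5 ℕ.^ (3 ℕ.+ j ℕ.* 2) ℕ.* N) (F₅.trans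
      (≡⇒≡₅ (≡.sym (U₅^-coeff (3 ℕ.+ j ℕ.* 2) Q N)))
      (F₅.trans (coeff (U₅^-Q j) N) (H-vanish N (transfer r≢0) (transfer r≢2) (transfer r≢3)))))
    where
    N = 5 ℕ.* n ℕ.+ r
    residue : N % 5 ≡ r % 5
    residue = ≡.trans (≡.cong (_% 5) (≡.trans (ℕ.+-comm (5 ℕ.* n) r) (≡.cong (r ℕ.+_) (ℕ.*-comm 5 n))))
      (ℕ.[m+kn]%n≡m%n r n 5)
    transfer : ∀ {s} → r % 5 ≢ s → N % 5 ≢ s
    transfer r≢s N≡s = r≢s (≡.trans (≡.sym residue) N≡s)
    exponent : 3 ℕ.+ j ℕ.* 2 ≡ 2 ℕ.* suc j ℕ.+ 1
    exponent = ≡.trans (ℕ.+-comm 1 (suc j ℕ.* 2)) (≡.cong (ℕ._+ 1) (ℕ.*-comm (suc j) 2))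

open import Data.Nat using (_+_; _*_; _^_)
open import Data.Nat.Divisibility using (_∣_)

theorem3 : (α n : ℕ) → 1 ≤ α →
    (5 ∣ p̄ (5 ^ (2 * α + 1) * (5 * n + 1))) × (5 ∣ p̄ (5 ^ (2 * α + 1) * (5 * n + 4)))
theorem3 (suc j) n _ =
  ThetaSeries.5∣p̄-odd-power j n 1 (λ ()) (λ ()) (λ ()) ,
  ThetaSeries.5∣p̄-odd-power j n 4 (λ ()) (λ ()) (λ ())
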